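{- Fix a field $K$. The class $\mathcal M_{QG}$ of matroids $M$ whose toric ideal $J_M$ has a Gr\"obner basis (with respect to some monomial order) consisting of quadratic binomials, and the class $\mathcal M_Q$ of matroids $M$ whose toric ideal $J_M$ is generated by quadratic binomials, are each closed under series extensions and parallel extensions: if $M$ belongs to the class, then so does every series extension and every parallel extension of $M$.
   Context: For a matroid $M$ on a finite ground set $E$ with bases $B_1,\dots,B_n$, the toric ideal $J_M$ is the kernel of the $K$-algebra homomorphism $K[x_1,\dots,x_n]\to K[s_e:e\in E]$, $x_j\mapsto\prod_{e\in B_j}s_e$. For a matroid $M$ on $[d]$ and $c\in[d]$, the series extension $M+_c(d+1)$ is the matroid on $[d+1]$ with bases $\{B\cup\{d+1\}: B\text{ a basis of }M\}\cup\{B\cup\{c\}: B\text{ a basis of }M,\ c\notin B\}$. The dual $M^*$ of $M$ is the matroid on $E$ whose bases are the complements $E\setminus B$ of bases $B$ of $M$. The parallel extension of $M$ at $c$ by $d+1$ is $(M^*+_c(d+1))^*$. -}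

module Defs where

open import Level using (Level; _⊔_; suc)
import Level
open import Data.Bool using (Bool; true; false; if_then_else_; _∧_; not)
open import Data.Nat as ℕ using (ℕ; zero; _≤_)
open import Data.Fin using (Fin)
open import Data.Vec as V using (Vec; []; _∷_; lookup; tabulate; zipWith; _[_]≔_; init; last; _∷ʳ_)
open import Data.Vec.Properties using (≡-dec)
open import Data.List as L using (List; []; _∷_; _++_; filter; length; concatMap)
open import Data.List.Relation.Unary.All using (All)
open import Data.List.Membership.Propositional using (_∈_)
open import Data.Product using (Σ; ∃; _×_; _,_; proj₁; proj₂)
open import Data.Sum using (_⊎_)
open import Relation.Nullary using (¬_; yes; no)
open import Relation.Binary.PropositionalEquality using (_≡_)
open import Relation.Binary.Structures using (IsStrictTotalOrder)
open import Induction.WellFounded using (WellFounded)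
open import Algebra.Bundles using (CommutativeRing)
open import Data.Bool.Properties using () renaming (_≟_ to _≟B_)

record Field (c ℓ : Level) : Set (suc (c ⊔ ℓ)) where
  field
    commRing : CommutativeRing c ℓ
  open CommutativeRing commRing public
  field
    1≉0     : ¬ (1# ≈ 0#)
    inverse : ∀ x → ¬ (x ≈ 0#) → ∃ λ y → (x * y) ≈ 1#

-- Matroids on the ground set [d] = Fin d, given by their set of bases
-- (a subset of Fin d is a Vec Bool d; true = member).

SubsetD : ℕ → Set
SubsetD d = Vec Bool d

BasisPred : ℕ → Set
BasisPred d = SubsetD d → Bool

record IsMatroid {d : ℕ} (isB : BasisPred d) : Set where
  field
    nonempty : ∃ λ B → isB B ≡ true
    exchange : ∀ B₁ B₂ → isB B₁ ≡ true → isB B₂ ≡ true →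
               ∀ x → lookup B₁ x ≡ true → lookup B₂ x ≡ false →
               ∃ λ y → lookup B₂ y ≡ true × lookup B₁ y ≡ false ×
                       isB ((B₁ [ x ]≔ false) [ y ]≔ true) ≡ true

allSubsets : (d : ℕ) → List (SubsetD d)
allSubsets zero = [] ∷ []
allSubsets (ℕ.suc d) = L.map (true ∷_) (allSubsets d) ++ L.map (false ∷_) (allSubsets d)

bases : {d : ℕ} → BasisPred d → List (SubsetD d)
bases isB = filter (λ B → isB B ≟B true) (allSubsets _)

dual : {d : ℕ} → BasisPred d → BasisPred d
dual isB S = isB (V.map not S)

-- series extension M +_c (d+1); the new element d+1 is the last
-- coordinate of Fin (d+1) (index fromℕ d).
-- S ⊆ [d+1] is a basis iff (d+1 ∈ S and S ∖ {d+1} is a basis of M) or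
-- (d+1 ∉ S, c ∈ S and S ∖ {c} is a basis of M (which then misses c)).
series : {d : ℕ} → BasisPred d → Fin d → BasisPred (ℕ.suc d)
series isB c S =
  if last S then isB (init S)
  else (lookup (init S) c ∧ isB (init S [ c ]≔ false))

parallel : {d : ℕ} → BasisPred d → Fin d → BasisPred (ℕ.suc d)
parallel isB c = dual (series (dual isB) c)

Mono : ℕ → Set
Mono n = Vec ℕ n

_·ₘ_ : {n : ℕ} → Mono n → Mono n → Mono n
_·ₘ_ = zipWith ℕ._+_

degree : {n : ℕ} → Mono n → ℕ
degree = V.sum

_∣ₘ_ : {n : ℕ} → Mono n → Mono n → Set
a ∣ₘ b = ∀ i → lookup a i ≤ lookup b i

module Poly {c ℓ : Level} (K : Field c ℓ) where
  open Field K

  Pol : ℕ → Set c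
  Pol n = List (Carrier × Mono n)

  coeff : {n : ℕ} → Pol n → Mono n → Carrier
  coeff [] m = 0#
  coeff ((a , u) ∷ p) m with ≡-dec ℕ._≟_ u m
  ... | yes _ = a + coeff p m
  ... | no  _ = coeff p m

  _≃_ : {n : ℕ} → Pol n → Pol n → Set ℓ
  p ≃ q = ∀ m → coeff p m ≈ coeff q m

  _⊕_ : {n : ℕ} → Pol n → Pol n → Pol n
  _⊕_ = _++_

  _⊗_ : {n : ℕ} → Pol n → Pol n → Pol n
  p ⊗ q = concatMap (λ t → L.map (λ s → (proj₁ t * proj₁ s , proj₂ t ·ₘ proj₂ s)) q) p

  binomial : {n : ℕ} → Mono n → Mono n → Pol n
  binomial a b = (1# , a) ∷ (- 1# , b) ∷ []

  InIdeal : {n : ℕ} → List (Pol n) → Pol n → Set (c ⊔ ℓ)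
  InIdeal G f = ∃ λ (hs : List (Pol n × Pol n)) →
    All (λ hg → proj₂ hg ∈ G) hs ×
    f ≃ L.foldr (λ hg acc → (proj₁ hg ⊗ proj₂ hg) ⊕ acc) [] hs
    where n = _

  -- Toric ideal of a matroid: kernel of x_j ↦ ∏_{e ∈ B_j} s_e.

  module Toric {d : ℕ} (isB : BasisPred d) where
    Bs : List (SubsetD d)
    Bs = bases isB

    nvars : ℕ
    nvars = length Bs

    -- exponent of the image of x^a in K[s_e : e ∈ E]
    image : Mono nvars → Mono d
    image a = tabulate λ e →
      V.sum (tabulate λ j → lookup a j ℕ.* (if lookup (L.lookup Bs j) e then 1 else 0))

    φ : Pol nvars → Pol d
    φ = L.map (λ t → proj₁ t , image (proj₂ t))

    InJ : Pol nvars → Set ℓ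
    InJ f = ∀ u → coeff (φ f) u ≈ 0#

    QuadGenerated : Set (c ⊔ ℓ)
    QuadGenerated = ∃ λ (G : List (Mono nvars × Mono nvars)) →
      All (λ ab → degree (proj₁ ab) ≡ 2 × degree (proj₂ ab) ≡ 2) G ×
      All (λ ab → InJ (binomial (proj₁ ab) (proj₂ ab))) G ×
      (∀ f → InJ f → InIdeal (L.map (λ ab → binomial (proj₁ ab) (proj₂ ab)) G) f)

  record MonomialOrder (n : ℕ) : Set₁ where
    field
      _<_   : Mono n → Mono n → Set
      isSTO : IsStrictTotalOrder _≡_ _<_
      wf    : WellFounded _<_
      mult  : ∀ a b m → a < b → (a ·ₘ m) < (b ·ₘ m)

  IsInit : {n : ℕ} → MonomialOrder n → Pol n → Mono n → Set ℓ
  IsInit O f m = ¬ (coeff f m ≈ 0#) ×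
    (∀ m' → ¬ (coeff f m' ≈ 0#) → (m' < m) ⊎ (m' ≡ m))
    where open MonomialOrder O

  IsGroebner : {n : ℕ} → MonomialOrder n → (Pol n → Set ℓ) → List (Pol n) → Set (c ⊔ ℓ)
  IsGroebner O I G = All I G ×
    (∀ f m → I f → IsInit O f m →
       ∃ λ g → g ∈ G × ∃ λ mg → IsInit O g mg × mg ∣ₘ m)

  module ToricGB {d : ℕ} (isB : BasisPred d) where
    open Toric isB
    QuadGroebner : Set (suc Level.zero ⊔ c ⊔ ℓ)
    QuadGroebner = ∃ λ (O : MonomialOrder nvars) →
      ∃ λ (G : List (Mono nvars × Mono nvars)) →
      All (λ ab → degree (proj₁ ab) ≡ 2 × degree (proj₂ ab) ≡ 2) G ×
      IsGroebner O InJ (L.map (λ ab → binomial (proj₁ ab) (proj₂ ab)) G)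

InMQG : ∀ {c ℓ} → Field c ℓ → {d : ℕ} → BasisPred d → Set (suc Level.zero ⊔ c ⊔ ℓ)
InMQG K isB = Poly.ToricGB.QuadGroebner K isB

InMQ : ∀ {c ℓ} → Field c ℓ → {d : ℕ} → BasisPred d → Set (c ⊔ ℓ)
InMQ K isB = Poly.Toric.QuadGenerated K isB

{-# OPTIONS --safe #-}
module Submission where

-- Both ideal-theoretic conditions are first made combinatorial.  Write im for
-- the exponent map of the toric parametrisation.  The ideal is generated by
-- quadrics iff monomials with equal image are connected by moves
-- xᵢxⱼu → xₖxₗu with im (xᵢxⱼ) = im (xₖxₗ), and a monomial order admits a
-- quadratic Gröbner basis iff every monomial that is not the least one of its
-- fibre is divisible by some xᵢxⱼ with a smaller xₖxₗ in the same fibre.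
--
-- A basis of a series extension at c by e is B ∪ e ("unmarked") or, if c ∉ B,
-- B ∪ c ("marked"); a basis of a parallel extension is B or, if c ∈ B,
-- B ∖ c ∪ e.  So a monomial of the extension is a monomial of M together with
-- a marking of some of its factors, and its image records exactly the image in M
-- and the number of marks (for series extensions this count comes from the
-- degree, which the image determines because bases are equicardinal).  A
-- relation xᵢxⱼ ~ xₖxₗ of M preserves the number of markable factors, hence
-- lifts to any marking; monomials that differ only in the position of their
-- marks are joined by trading marks, which is quadratic.  For Gröbner bases
-- compare first the underlying monomials of M and then, by the same order,
-- their marked parts.

open import Defs
open import Data.Nat using (ℕ)
open import Data.Fin using (Fin)
open import Data.Product using (_×_; _,_)

-- Exponent vectors as a free commutative monoid.

module Monomials where
  open import Level using (0ℓ)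
  open import Data.Nat using (ℕ; zero; suc; _+_; _*_; _<_; _≤_; _∸_; z≤n; s≤s)
  import Data.Nat.Properties as ℕ
  open import Data.Fin using (Fin; zero; suc)
  open import Data.Vec as V using ([]; _∷_; lookup; tabulate; replicate)
  open import Data.Vec.Properties using (lookup∘tabulate; tabulate∘lookup; tabulate-cong; lookup-zipWith; lookup-replicate; zipWith-comm; zipWith-assoc; zipWith-identityˡ; zipWith-identityʳ; ∷-injectiveʳ; ∷-injectiveˡ)
  open import Data.Product using (∃; ∃₂; _×_; _,_)
  open import Data.Sum using (_⊎_; inj₁; inj₂)
  open import Data.Empty using (⊥-elim)
  open import Relation.Nullary using (yes; no)
  open import Relation.Binary.PropositionalEquality
  open import Function using (_∘_)
  open import Algebra.Bundles using (CommutativeSemigroup)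
  import Algebra.Properties.CommutativeSemigroup as CSG

  private variable
    n N : ℕ

  ·-comm : (a b : Mono n) → a ·ₘ b ≡ b ·ₘ a
  ·-comm = zipWith-comm ℕ.+-comm

  ·-assoc : (a b c : Mono n) → (a ·ₘ b) ·ₘ c ≡ a ·ₘ (b ·ₘ c)
  ·-assoc = zipWith-assoc ℕ.+-assoc

  ·-commutativeSemigroup : ℕ → CommutativeSemigroup 0ℓ 0ℓ
  ·-commutativeSemigroup n = record
    { Carrier = Mono n ; _≈_ = _≡_ ; _∙_ = _·ₘ_
    ; isCommutativeSemigroup = record
      { isSemigroup = record
        { isMagma = record { isEquivalence = isEquivalence ; ∙-cong = cong₂ _·ₘ_ }
        ; assoc = ·-assoc }
      ; comm = ·-comm } }

  module Mono· {n} = CSG (·-commutativeSemigroup n)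
  module ℕ+ = CSG ℕ.+-commutativeSemigroup

  1ₘ : Mono n
  1ₘ = replicate _ 0

  ·-identityˡ : (a : Mono n) → 1ₘ ·ₘ a ≡ a
  ·-identityˡ = zipWith-identityˡ ℕ.+-identityˡ

  ·-identityʳ : (a : Mono n) → a ·ₘ 1ₘ ≡ a
  ·-identityʳ = zipWith-identityʳ ℕ.+-identityʳ

  ·-cancelˡ : (a : Mono n) {b c : Mono n} → a ·ₘ b ≡ a ·ₘ c → b ≡ c
  ·-cancelˡ []      {[]}    {[]}    _  = refl
  ·-cancelˡ (k ∷ a) {x ∷ b} {y ∷ c} eq =
    cong₂ _∷_ (ℕ.+-cancelˡ-≡ k x y (∷-injectiveˡ eq)) (·-cancelˡ a (∷-injectiveʳ eq))

  ∣ₘ⇒· : {a b : Mono n} → a ∣ₘ b → ∃ λ u → b ≡ a ·ₘ u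
  ∣ₘ⇒· {a = []}    {[]}    _ = [] , refl
  ∣ₘ⇒· {a = x ∷ a} {y ∷ b} h with ∣ₘ⇒· {a = a} {b} (h ∘ suc)
  ... | u , eq = y ∸ x ∷ u , cong₂ _∷_ (sym (ℕ.m+[n∸m]≡n (h zero))) eq

  ·⇒∣ₘ : (a u : Mono n) → a ∣ₘ (a ·ₘ u)
  ·⇒∣ₘ a u i = subst (lookup a i ≤_) (sym (lookup-zipWith _+_ i a u)) (ℕ.m≤m+n _ _)

  δ : Fin n → Mono n
  δ zero    = 1 ∷ 1ₘ
  δ (suc i) = 0 ∷ δ i

  lookup-δ : (i : Fin n) → lookup (δ i) i ≡ 1
  lookup-δ zero    = refl
  lookup-δ (suc i) = lookup-δ i

  lookup-δ⁻ : (i j : Fin n) → 0 < lookup (δ i) j → i ≡ j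
  lookup-δ⁻ zero    zero    _ = refl
  lookup-δ⁻ zero    (suc j) p = ⊥-elim (ℕ.n≮0 (subst (0 <_) (lookup-replicate j 0) p))
  lookup-δ⁻ (suc i) (suc j) p = cong suc (lookup-δ⁻ i j p)

  split : (m : Mono n) (i : Fin n) → 0 < lookup m i → ∃ λ u → m ≡ δ i ·ₘ u
  split (suc k ∷ m) zero    _ = k ∷ m , cong (suc k ∷_) (sym (·-identityˡ m))
  split (k ∷ m)     (suc i) p with split m i p
  ... | u , eq = k ∷ u , cong (k ∷_) eq

  1ₘ-or-split : (m : Mono n) → m ≡ 1ₘ ⊎ ∃₂ λ i u → m ≡ δ i ·ₘ u
  1ₘ-or-split []          = inj₁ refl
  1ₘ-or-split (suc k ∷ m) = inj₂ (zero , split (suc k ∷ m) zero (s≤s z≤n))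
  1ₘ-or-split (zero ∷ m) with 1ₘ-or-split m
  ... | inj₁ eq            = inj₁ (cong (0 ∷_) eq)
  ... | inj₂ (i , u , eq) = inj₂ (suc i , 0 ∷ u , cong (0 ∷_) eq)

  -- Additive weights and homomorphisms of monomials.

  ⟨_,_⟩ : (Fin n → ℕ) → Mono n → ℕ
  ⟨ w , m ⟩ = V.sum (tabulate λ j → lookup m j * w j)

  ⟨⟩-1ₘ : (w : Fin n → ℕ) → ⟨ w , 1ₘ ⟩ ≡ 0
  ⟨⟩-1ₘ {zero}  w = refl
  ⟨⟩-1ₘ {suc n} w = ⟨⟩-1ₘ (w ∘ suc)

  ⟨⟩-· : (w : Fin n → ℕ) (a b : Mono n) → ⟨ w , a ·ₘ b ⟩ ≡ ⟨ w , a ⟩ + ⟨ w , b ⟩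
  ⟨⟩-· w []      []      = refl
  ⟨⟩-· w (x ∷ a) (y ∷ b) =
    trans (cong₂ _+_ (ℕ.*-distribʳ-+ (w zero) x y) (⟨⟩-· (w ∘ suc) a b))
          (ℕ+.interchange (x * w zero) (y * w zero) _ _)

  ⟨⟩-δ : (w : Fin n → ℕ) (i : Fin n) → ⟨ w , δ i ⟩ ≡ w i
  ⟨⟩-δ w zero    = trans (cong₂ _+_ (ℕ.*-identityˡ _) (⟨⟩-1ₘ (w ∘ suc))) (ℕ.+-identityʳ _)
  ⟨⟩-δ w (suc i) = ⟨⟩-δ (w ∘ suc) i

  ⟨⟩-δ· : (w : Fin n → ℕ) (i : Fin n) (m : Mono n) → ⟨ w , δ i ·ₘ m ⟩ ≡ w i + ⟨ w , m ⟩
  ⟨⟩-δ· w i m = trans (⟨⟩-· w (δ i) m) (cong (_+ _) (⟨⟩-δ w i))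

  ⟨⟩-δδ : (w : Fin n → ℕ) (i j : Fin n) → ⟨ w , δ i ·ₘ δ j ⟩ ≡ w i + w j
  ⟨⟩-δδ w i j = trans (⟨⟩-δ· w i (δ j)) (cong (w i +_) (⟨⟩-δ w j))

  ⟨⟩-cong : {w w' : Fin n → ℕ} → (∀ i → w i ≡ w' i) → ∀ m → ⟨ w , m ⟩ ≡ ⟨ w' , m ⟩
  ⟨⟩-cong h []      = refl
  ⟨⟩-cong h (k ∷ m) = cong₂ _+_ (cong (k *_) (h zero)) (⟨⟩-cong (h ∘ suc) m)

  ⟨⟩-+ : (w w' : Fin n → ℕ) (m : Mono n) → ⟨ (λ i → w i + w' i) , m ⟩ ≡ ⟨ w , m ⟩ + ⟨ w' , m ⟩
  ⟨⟩-+ w w' []      = refl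
  ⟨⟩-+ w w' (k ∷ m) =
    trans (cong₂ _+_ (ℕ.*-distribˡ-+ k (w zero) (w' zero)) (⟨⟩-+ (w ∘ suc) (w' ∘ suc) m))
          (ℕ+.interchange (k * w zero) (k * w' zero) _ _)

  ⟨⟩-const : (k : ℕ) (m : Mono n) → ⟨ (λ _ → k) , m ⟩ ≡ degree m * k
  ⟨⟩-const k []      = refl
  ⟨⟩-const k (x ∷ m) = trans (cong (x * k +_) (⟨⟩-const k m)) (sym (ℕ.*-distribʳ-+ k x (degree m)))

  degree-⟨⟩ : (m : Mono n) → ⟨ (λ _ → 1) , m ⟩ ≡ degree m
  degree-⟨⟩ m = trans (⟨⟩-const 1 m) (ℕ.*-identityʳ _)

  degree-δ· : (i : Fin n) (m : Mono n) → degree (δ i ·ₘ m) ≡ suc (degree m)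
  degree-δ· i m = trans (sym (degree-⟨⟩ (δ i ·ₘ m))) (trans (⟨⟩-δ· _ i m) (cong suc (degree-⟨⟩ m)))

  degree-δδ : (i j : Fin n) → degree (δ i ·ₘ δ j) ≡ 2
  degree-δδ i j = trans (sym (degree-⟨⟩ (δ i ·ₘ δ j))) (⟨⟩-δδ _ i j)

  degree-1ₘ : degree (1ₘ {n}) ≡ 0
  degree-1ₘ {n} = trans (sym (degree-⟨⟩ (1ₘ {n}))) (⟨⟩-1ₘ {n} _)

  degree≡0 : (m : Mono n) → degree m ≡ 0 → m ≡ 1ₘ
  degree≡0 m eq with 1ₘ-or-split m
  ... | inj₁ h             = h
  ... | inj₂ (i , u , refl) with () ← trans (sym (degree-δ· i u)) eq

  degree≡suc : (m : Mono n) {k : ℕ} → degree m ≡ suc k → ∃₂ λ i u → m ≡ δ i ·ₘ u × degree u ≡ k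
  degree≡suc {n} m eq with 1ₘ-or-split m
  ... | inj₁ refl with () ← trans (sym (degree-1ₘ {n})) eq
  ... | inj₂ (i , u , refl) = i , u , refl , ℕ.suc-injective (trans (sym (degree-δ· i u)) eq)

  degree≡2 : (m : Mono n) → degree m ≡ 2 → ∃₂ λ i j → m ≡ δ i ·ₘ δ j
  degree≡2 m eq with degree≡suc m eq
  ... | i , u , refl , eq₁ with degree≡suc u eq₁
  ...   | j , v , refl , eq₂ = i , j , cong (δ i ·ₘ_) (trans (cong (δ j ·ₘ_) (degree≡0 v eq₂)) (·-identityʳ (δ j)))

  -- Recursion on the degree replaces the vector representation by a product of variables, so
  -- additive functions can be checked one variable at a time.
  mono-rec : ∀ {p} (P : Mono n → Set p) → P 1ₘ → (∀ i u → P u → P (δ i ·ₘ u)) → ∀ m → P m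
  mono-rec {n} P base step m = go (degree m) m refl
    where
    go : ∀ k m → degree m ≡ k → P m
    go zero    m eq = subst P (sym (degree≡0 m eq)) base
    go (suc k) m eq with degree≡suc m eq
    ... | i , u , refl , equ = step i u (go k u equ)

  hom : (Fin N → Fin n → ℕ) → Mono N → Mono n
  hom f m = tabulate λ e → ⟨ (λ j → f j e) , m ⟩

  lookup-hom : (f : Fin N → Fin n → ℕ) (m : Mono N) (e : Fin n) → lookup (hom f m) e ≡ ⟨ (λ j → f j e) , m ⟩
  lookup-hom f m e = lookup∘tabulate _ e

  ≡-lookup : {a b : Mono n} → (∀ i → lookup a i ≡ lookup b i) → a ≡ b
  ≡-lookup h = trans (sym (tabulate∘lookup _)) (trans (tabulate-cong h) (tabulate∘lookup _))

  hom-· : (f : Fin N → Fin n → ℕ) (a b : Mono N) → hom f (a ·ₘ b) ≡ hom f a ·ₘ hom f b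
  hom-· f a b = ≡-lookup λ e → begin
    lookup (hom f (a ·ₘ b)) e                     ≡⟨ lookup-hom f (a ·ₘ b) e ⟩
    ⟨ (λ j → f j e) , a ·ₘ b ⟩                    ≡⟨ ⟨⟩-· _ a b ⟩
    ⟨ (λ j → f j e) , a ⟩ + ⟨ (λ j → f j e) , b ⟩ ≡⟨ cong₂ _+_ (lookup-hom f a e) (lookup-hom f b e) ⟨
    lookup (hom f a) e + lookup (hom f b) e       ≡⟨ lookup-zipWith _+_ e (hom f a) (hom f b) ⟨
    lookup (hom f a ·ₘ hom f b) e                 ∎
    where open ≡-Reasoning

  hom-δ : (f : Fin N → Mono n) (j : Fin N) → hom (lookup ∘ f) (δ j) ≡ f j
  hom-δ f j = ≡-lookup λ e → trans (lookup-hom _ (δ j) e) (⟨⟩-δ (λ j → lookup (f j) e) j)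

  hom-δ· : (f : Fin N → Mono n) (j : Fin N) (m : Mono N) → hom (lookup ∘ f) (δ j ·ₘ m) ≡ f j ·ₘ hom (lookup ∘ f) m
  hom-δ· f j m = trans (hom-· (lookup ∘ f) (δ j) m) (cong (_·ₘ _) (hom-δ f j))

  hom-δδ : (f : Fin N → Mono n) (i j : Fin N) → hom (lookup ∘ f) (δ i ·ₘ δ j) ≡ f i ·ₘ f j
  hom-δδ f i j = trans (hom-δ· f i (δ j)) (cong (f i ·ₘ_) (hom-δ f j))

  hom-1ₘ : (f : Fin N → Fin n → ℕ) → hom f 1ₘ ≡ 1ₘ
  hom-1ₘ f = ≡-lookup λ e → trans (lookup-hom f 1ₘ e) (trans (⟨⟩-1ₘ (λ j → f j e)) (sym (lookup-replicate e 0)))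

  ⟨⟩-hom : (w : Fin n → ℕ) (f : Fin N → Mono n) (m : Mono N) →
           ⟨ w , hom (lookup ∘ f) m ⟩ ≡ ⟨ (λ j → ⟨ w , f j ⟩) , m ⟩
  ⟨⟩-hom w f = mono-rec _ base step
    where
    base : ⟨ w , hom (lookup ∘ f) 1ₘ ⟩ ≡ ⟨ (λ j → ⟨ w , f j ⟩) , 1ₘ ⟩
    base = trans (cong ⟨ w ,_⟩ (hom-1ₘ (lookup ∘ f))) (trans (⟨⟩-1ₘ w) (sym (⟨⟩-1ₘ (λ j → ⟨ w , f j ⟩))))
    step : ∀ i u → ⟨ w , hom (lookup ∘ f) u ⟩ ≡ ⟨ (λ j → ⟨ w , f j ⟩) , u ⟩ →
           ⟨ w , hom (lookup ∘ f) (δ i ·ₘ u) ⟩ ≡ ⟨ (λ j → ⟨ w , f j ⟩) , δ i ·ₘ u ⟩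
    step i u ih = begin
      ⟨ w , hom (lookup ∘ f) (δ i ·ₘ u) ⟩         ≡⟨ cong ⟨ w ,_⟩ (hom-δ· f i u) ⟩
      ⟨ w , f i ·ₘ hom (lookup ∘ f) u ⟩           ≡⟨ ⟨⟩-· w (f i) _ ⟩
      ⟨ w , f i ⟩ + ⟨ w , hom (lookup ∘ f) u ⟩    ≡⟨ cong (⟨ w , f i ⟩ +_) ih ⟩
      ⟨ w , f i ⟩ + ⟨ (λ j → ⟨ w , f j ⟩) , u ⟩   ≡⟨ ⟨⟩-δ· _ i u ⟨
      ⟨ (λ j → ⟨ w , f j ⟩) , δ i ·ₘ u ⟩          ∎
      where open ≡-Reasoning

  -- A sum of natural numbers is positive only if one summand is; the variable responsible for it is
  -- split off.
  hom-pull : (f : Fin N → Mono n) (m : Mono N) (i : Fin n) → 0 < lookup (hom (lookup ∘ f) m) i →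
             ∃₂ λ v u → m ≡ δ v ·ₘ u × 0 < lookup (f v) i
  hom-pull f m i = mono-rec (λ m → 0 < lookup (hom (lookup ∘ f) m) i → ∃₂ λ v u → m ≡ δ v ·ₘ u × 0 < lookup (f v) i)
    (λ p → ⊥-elim (ℕ.n≮0 (subst (0 <_) (trans (cong (λ a → lookup a i) (hom-1ₘ (lookup ∘ f))) (lookup-replicate i 0)) p)))
    step m
    where
    step : ∀ j u → (0 < lookup (hom (lookup ∘ f) u) i → ∃₂ λ v x → u ≡ δ v ·ₘ x × 0 < lookup (f v) i) →
           0 < lookup (hom (lookup ∘ f) (δ j ·ₘ u)) i → ∃₂ λ v x → δ j ·ₘ u ≡ δ v ·ₘ x × 0 < lookup (f v) i
    step j u ih p with 0 ℕ.<? lookup (f j) i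
    ... | yes q = j , u , refl , q
    ... | no ¬q with ih (subst (0 <_) eq p)
      where
      eq : lookup (hom (lookup ∘ f) (δ j ·ₘ u)) i ≡ lookup (hom (lookup ∘ f) u) i
      eq = trans (cong (λ a → lookup a i) (hom-δ· f j u))
           (trans (lookup-zipWith _+_ i (f j) _) (cong (_+ _) (ℕ.n≤0⇒n≡0 (ℕ.≮⇒≥ ¬q))))
    ... | v , x , refl , r = v , δ j ·ₘ x , Mono·.x∙yz≈y∙xz (δ j) (δ v) x , r

-- Quadratic moves and their lifting to marked variables.

module Covers where
  open Monomials
  open import Data.Bool using (Bool; true; false; if_then_else_)
  open import Data.Nat using (ℕ; zero; suc; _+_; _<_; _≤_; z≤n; s≤s)
  import Data.Nat.Properties as ℕ
  open import Data.Fin using (Fin)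
  open import Data.Vec using (lookup)
  open import Data.Vec.Properties using (lookup-zipWith)
  open import Data.Product using (∃; ∃₂; _×_; _,_)
  open import Data.Empty using (⊥-elim)
  open import Relation.Binary.PropositionalEquality
  open import Relation.Binary.Construct.Closure.ReflexiveTransitive using (Star; ε; _◅_; _◅◅_; gmap; reverse)
  open import Function using (_∘_)

  private variable
    n N d e : ℕ

  -- Equality is required of the two quadrics: the binomial of `a` and `b` is then a monomial
  -- multiple of a single quadratic binomial.
  record Step (im : Mono n → Mono d) (a b : Mono n) : Set where
    constructor step
    field
      {i j k l} : Fin n
      u         : Mono n
      source    : a ≡ (δ i ·ₘ δ j) ·ₘ u
      target    : b ≡ (δ k ·ₘ δ l) ·ₘ u
      same      : im (δ i ·ₘ δ j) ≡ im (δ k ·ₘ δ l)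

  Step-sym : {im : Mono n → Mono d} {a b : Mono n} → Step im a b → Step im b a
  Step-sym (step u s t eq) = step u t s (sym eq)

  Step-· : {im : Mono n → Mono d} (v : Mono n) {a b : Mono n} → Step im a b → Step im (v ·ₘ a) (v ·ₘ b)
  Step-· v (step {i} {j} {k} {l} u refl refl eq) =
    step (v ·ₘ u) (Mono·.x∙yz≈y∙xz v (δ i ·ₘ δ j) u) (Mono·.x∙yz≈y∙xz v (δ k ·ₘ δ l) u) eq

  Moves : (im : Mono n → Mono d) → Mono n → Mono n → Set
  Moves im = Star (Step im)

  Moves-sym : {im : Mono n → Mono d} {a b : Mono n} → Moves im a b → Moves im b a
  Moves-sym = reverse Step-sym

  Moves-· : {im : Mono n → Mono d} (v : Mono n) {a b : Mono n} → Moves im a b → Moves im (v ·ₘ a) (v ·ₘ b)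
  Moves-· v = gmap (v ·ₘ_) (Step-· v)

  Connected : (Mono n → Mono d) → Set
  Connected im = ∀ m m' → im m ≡ im m' → Moves im m m'

  bit : Bool → ℕ
  bit b = if b then 1 else 0

  -- The variables of the target are those of the source, each available
  -- unmarked and, if D allows, also marked.
  record Cover (im : Mono n → Mono d) (im' : Mono N → Mono e) : Set where
    field
      π      : Fin N → Fin n
      marked : Fin N → Bool
      D      : Fin n → Bool

    push : Mono N → Mono n
    push = hom (lookup ∘ δ ∘ π)

    mark : Fin N → ℕ
    mark = bit ∘ marked

    field
      injective : ∀ {v w} → π v ≡ π w → marked v ≡ marked w → v ≡ w
      markable  : ∀ {v} → marked v ≡ true → D (π v) ≡ true
      lift      : ∀ i b → (b ≡ true → D i ≡ true) → ∃ λ v → π v ≡ i × marked v ≡ b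
      image⇒    : ∀ m m' → im' m ≡ im' m' → im (push m) ≡ im (push m') × ⟨ mark , m ⟩ ≡ ⟨ mark , m' ⟩
      -- Products of two variables suffice here, because only quadratic relations are ever carried
      -- upwards.
      image⇐    : ∀ {v w v' w'} → im (δ (π v) ·ₘ δ (π w)) ≡ im (δ (π v') ·ₘ δ (π w')) →
                  mark v + mark w ≡ mark v' + mark w' → im' (δ v ·ₘ δ w) ≡ im' (δ v' ·ₘ δ w')
      D-count   : ∀ {i j k l} → im (δ i ·ₘ δ j) ≡ im (δ k ·ₘ δ l) → bit (D i) + bit (D j) ≡ bit (D k) + bit (D l)

    push-δ· : ∀ v m → push (δ v ·ₘ m) ≡ δ (π v) ·ₘ push m
    push-δ· = hom-δ· (δ ∘ π)

    push-δδ : ∀ v w → push (δ v ·ₘ δ w) ≡ δ (π v) ·ₘ δ (π w)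
    push-δδ = hom-δδ (δ ∘ π)

    mark≤D : ∀ v → mark v ≤ bit (D (π v))
    mark≤D v with marked v in eq
    ... | false = z≤n
    ... | true rewrite markable eq = ℕ.≤-refl

    -- The `s` marks are placed greedily, on `k` first if it is markable and then on `l`; the bound
    -- guarantees enough room.
    lift-pair : ∀ k l s → s ≤ bit (D k) + bit (D l) →
                ∃₂ λ v w → π v ≡ k × π w ≡ l × mark v + mark w ≡ s
    lift-pair k l s s≤ with D k in Dk | D l in Dl
    ... | false | false with lift k false (λ ()) | lift l false (λ ()) | s≤
    ...   | v , pv , tv | w , pw , tw | z≤n = v , w , pv , pw , cong₂ (λ a b → bit a + bit b) tv tw
    lift-pair k l zero s≤ | _ | _ with lift k false (λ ()) | lift l false (λ ())
    ...   | v , pv , tv | w , pw , tw = v , w , pv , pw , cong₂ (λ a b → bit a + bit b) tv tw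
    lift-pair k l (suc zero) s≤ | true | _ with lift k true (λ _ → Dk) | lift l false (λ ())
    ...   | v , pv , tv | w , pw , tw = v , w , pv , pw , cong₂ (λ a b → bit a + bit b) tv tw
    lift-pair k l (suc zero) s≤ | false | true with lift k false (λ ()) | lift l true (λ _ → Dl)
    ...   | v , pv , tv | w , pw , tw = v , w , pv , pw , cong₂ (λ a b → bit a + bit b) tv tw
    lift-pair k l (suc (suc zero)) s≤ | true | true with lift k true (λ _ → Dk) | lift l true (λ _ → Dl)
    ...   | v , pv , tv | w , pw , tw = v , w , pv , pw , cong₂ (λ a b → bit a + bit b) tv tw
    lift-pair k l (suc (suc _)) (s≤s ()) | true | false
    lift-pair k l (suc (suc _)) (s≤s ()) | false | true
    lift-pair k l (suc (suc (suc _))) (s≤s (s≤s ())) | true | true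

    -- There are at most as many marks as markable factors, and `D-count` keeps the latter number,
    -- so the marks of `v` and `w` fit on `k` and `l`.
    lift-relation : ∀ v w {k l} → im (δ (π v) ·ₘ δ (π w)) ≡ im (δ k ·ₘ δ l) →
                    ∃₂ λ v' w' → π v' ≡ k × π w' ≡ l × mark v + mark w ≡ mark v' + mark w' ×
                                 im' (δ v ·ₘ δ w) ≡ im' (δ v' ·ₘ δ w')
    lift-relation v w {k} {l} eq
      with lift-pair k l (mark v + mark w) (ℕ.≤-trans (ℕ.+-mono-≤ (mark≤D v) (mark≤D w)) (ℕ.≤-reflexive (D-count eq)))
    ... | v' , w' , refl , refl , s = v' , w' , refl , refl , sym s , image⇐ {v} {w} {v'} {w'} eq (sym s)

    -- The factor found by `hom-pull` lies over `i` because `δ (π v)` is supported at `π v` alone;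
    -- cancelling it identifies what is left below.
    pull : ∀ i u m → push m ≡ δ i ·ₘ u → ∃₂ λ v x → m ≡ δ v ·ₘ x × π v ≡ i × push x ≡ u
    pull i u m eq with hom-pull (δ ∘ π) m i (subst (λ a → 0 < lookup a i) (sym eq) pos)
      where
      pos : 0 < lookup (δ i ·ₘ u) i
      pos = subst (0 <_) (sym (trans (lookup-zipWith _+_ i (δ i) u) (cong (_+ lookup u i) (lookup-δ i)))) (s≤s z≤n)
    ... | v , x , refl , p with lookup-δ⁻ (π v) i p
    ...   | refl = v , x , refl , refl , ·-cancelˡ (δ (π v)) (trans (sym (push-δ· v x)) eq)

    pull₂ : ∀ i j u m → push m ≡ (δ i ·ₘ δ j) ·ₘ u →
            ∃₂ λ v w → ∃ λ x → m ≡ (δ v ·ₘ δ w) ·ₘ x × π v ≡ i × π w ≡ j × push x ≡ u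
    pull₂ i j u m eq with pull i (δ j ·ₘ u) m (trans eq (·-assoc (δ i) (δ j) u))
    ... | v , x , refl , pv , eq₁ with pull j u x eq₁
    ...   | w , y , refl , pw , eq₂ = v , w , y , sym (·-assoc (δ v) (δ w) y) , pv , pw , eq₂

    degree-push : ∀ m → degree (push m) ≡ degree m
    degree-push m = begin
      degree (push m)                        ≡⟨ degree-⟨⟩ (push m) ⟨
      ⟨ (λ _ → 1) , push m ⟩                 ≡⟨ ⟨⟩-hom (λ _ → 1) (δ ∘ π) m ⟩
      ⟨ (λ j → ⟨ (λ _ → 1) , δ (π j) ⟩) , m ⟩ ≡⟨ ⟨⟩-cong (λ j → ⟨⟩-δ (λ _ → 1) (π j)) m ⟩
      ⟨ (λ _ → 1) , m ⟩                      ≡⟨ degree-⟨⟩ m ⟩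
      degree m                               ∎
      where open ≡-Reasoning

    mark-positive : ∀ m → 0 < ⟨ mark , m ⟩ → ∃₂ λ v u → m ≡ δ v ·ₘ u × marked v ≡ true
    mark-positive = mono-rec _ (λ p → ⊥-elim (ℕ.n≮0 (subst (0 <_) (⟨⟩-1ₘ mark) p))) go
      where
      go : ∀ i u → (0 < ⟨ mark , u ⟩ → ∃₂ λ v x → u ≡ δ v ·ₘ x × marked v ≡ true) →
           0 < ⟨ mark , δ i ·ₘ u ⟩ → ∃₂ λ v x → δ i ·ₘ u ≡ δ v ·ₘ x × marked v ≡ true
      go i u ih p with marked i in eq
      ... | true  = i , u , refl , eq
      ... | false with ih (subst (0 <_) (trans (⟨⟩-δ· mark i u) (cong (λ b → bit b + ⟨ mark , u ⟩) eq)) p)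
      ...   | v , x , refl , h = v , δ i ·ₘ x , Mono·.x∙yz≈y∙xz (δ i) (δ v) x , h

    -- Each step below replaces two factors, whose preimages are exchanged by `lift-relation`. The
    -- endpoint is controlled only up to the position of its marks, which `same-push⇒moves` repairs.
    lift-moves : ∀ m {a b} → push m ≡ a → Moves im a b →
                 ∃ λ m' → push m' ≡ b × ⟨ mark , m ⟩ ≡ ⟨ mark , m' ⟩ × Moves im' m m'
    lift-moves m eq ε = m , eq , refl , ε
    lift-moves m eq (step {i} {j} {k} {l} u refl refl same ◅ rest) with pull₂ i j u m eq
    ... | v , w , x , refl , refl , refl , refl with lift-relation v w same
    ...   | v' , w' , refl , refl , mk , rel
          with lift-moves ((δ v' ·ₘ δ w') ·ₘ x) (trans (hom-· _ (δ v' ·ₘ δ w') x) (cong (_·ₘ push x) (push-δδ v' w'))) rest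
    ...     | m' , p , q , moves = m' , p , trans mark-eq q , step x refl refl rel ◅ moves
      where
      mark-eq : ⟨ mark , (δ v ·ₘ δ w) ·ₘ x ⟩ ≡ ⟨ mark , (δ v' ·ₘ δ w') ·ₘ x ⟩
      mark-eq = trans (⟨⟩-· mark (δ v ·ₘ δ w) x) (trans (cong (_+ ⟨ mark , x ⟩)
        (trans (⟨⟩-δδ mark v w) (trans mk (sym (⟨⟩-δδ mark v' w'))))) (sym (⟨⟩-· mark (δ v' ·ₘ δ w') x)))

    -- Below, the two products agree up to order, so the relation demanded by `image⇐` is trivial
    -- and only the total of the marks matters.
    swap : ∀ {v w v' w'} → π v ≡ π w' → π w ≡ π v' → mark v + mark w ≡ mark v' + mark w' →
           im' (δ v ·ₘ δ w) ≡ im' (δ v' ·ₘ δ w')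
    swap {v} {w} {v'} {w'} p q = image⇐ {v} {w} {v'} {w'}
      (cong im (trans (cong₂ (λ i j → δ i ·ₘ δ j) p q) (·-comm (δ (π w')) (δ (π v')))))

    -- Induction on the degree. Factors `v` of `m` and `w` of `m'` over the same variable either
    -- coincide by `injective` and are cancelled, or differ in their mark, and then `remark` trades
    -- one first.
    same-push⇒moves : ∀ m m' → push m ≡ push m' → ⟨ mark , m ⟩ ≡ ⟨ mark , m' ⟩ → Moves im' m m'
    same-push⇒moves m m' = go (degree m) m m' refl
      where
      Goal : ℕ → Set
      Goal k = ∀ m m' → degree m ≡ k → push m ≡ push m' → ⟨ mark , m ⟩ ≡ ⟨ mark , m' ⟩ → Moves im' m m'

      -- As `w` is unmarked, `m'` carries one mark more than `m`, hence has a marked factor `x`.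
      -- Trading marks turns `w` into `v` and `x` into its unmarked copy `x̄`; now `v` is common and
      -- the induction handles the rest.
      remark : ∀ {k} → Goal k → ∀ v w m m' → degree m ≡ k → π v ≡ π w → marked v ≡ true → marked w ≡ false →
               push m ≡ push m' → ⟨ mark , δ v ·ₘ m ⟩ ≡ ⟨ mark , δ w ·ₘ m' ⟩ →
               Moves im' (δ w ·ₘ m') (δ v ·ₘ m)
      remark ih v w m m' deg pvw tv tw peq meq
        with suc-eq ← trans (sym (trans (⟨⟩-δ· mark v m) (cong (λ b → bit b + ⟨ mark , m ⟩) tv)))
                      (trans meq (trans (⟨⟩-δ· mark w m') (cong (λ b → bit b + ⟨ mark , m' ⟩) tw)))
        with mark-positive m' (subst (0 <_) suc-eq (s≤s z≤n))
      ... | x , u , refl , tx with lift (π x) false (λ ())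
      ...   | x̄ , px̄ , tx̄ =
        step u (sym (·-assoc (δ w) (δ x) u)) (sym (·-assoc (δ x̄) (δ v) u))
             (swap {w} {x} {x̄} {v} (sym pvw) (sym px̄)
                   (trans (cong₂ (λ a b → bit a + bit b) tw tx) (sym (cong₂ (λ a b → bit a + bit b) tx̄ tv))))
        ◅ subst (λ a → Moves im' a (δ v ·ₘ m)) (Mono·.x∙yz≈y∙xz (δ v) (δ x̄) u)
            (Moves-sym (Moves-· (δ v) (ih m (δ x̄ ·ₘ u) deg push-eq mark-eq)))
        where
        push-eq : push m ≡ push (δ x̄ ·ₘ u)
        push-eq = trans peq (trans (push-δ· x u) (trans (cong (λ i → δ i ·ₘ push u) (sym px̄)) (sym (push-δ· x̄ u))))
        mark-eq : ⟨ mark , m ⟩ ≡ ⟨ mark , δ x̄ ·ₘ u ⟩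
        mark-eq = ℕ.suc-injective (trans suc-eq (trans (⟨⟩-δ· mark x u) (trans
          (cong (λ b → bit b + ⟨ mark , u ⟩) tx) (cong suc (sym (trans (⟨⟩-δ· mark x̄ u) (cong (λ b → bit b + ⟨ mark , u ⟩) tx̄)))))))

      go : ∀ k → Goal k
      go zero m m' deg peq _ =
        subst₂ (Moves im') (sym (degree≡0 m deg))
          (sym (degree≡0 m' (trans (sym (degree-push m')) (trans (cong degree (sym peq)) (trans (degree-push m) deg))))) ε
      go (suc k) m m' deg peq meq with degree≡suc m deg
      ... | v , x , refl , dx with pull (π v) (push x) m' (trans (sym peq) (push-δ· v x))
      ...   | w , y , refl , pw , py with marked v in tv | marked w in tw
      ...     | true  | true  with refl ← injective pw (trans tw (sym tv)) =
        Moves-· (δ v) (go k x y dx (sym py) (ℕ.+-cancelˡ-≡ (mark v) _ _ (trans (sym (⟨⟩-δ· mark v x)) (trans meq (⟨⟩-δ· mark v y)))))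
      ...     | false | false with refl ← injective pw (trans tw (sym tv)) =
        Moves-· (δ v) (go k x y dx (sym py) (ℕ.+-cancelˡ-≡ (mark v) _ _ (trans (sym (⟨⟩-δ· mark v x)) (trans meq (⟨⟩-δ· mark v y)))))
      ...     | true  | false = Moves-sym (remark (go k) v w x y dx (sym pw) tv tw (sym py) meq)
      ...     | false | true  = remark (go k) w v y x dy pw tw tv py (sym meq)
        where
        dy : degree y ≡ k
        dy = trans (sym (degree-push y)) (trans (cong degree py) (trans (degree-push x) dx))

    Connected-cover : Connected im → Connected im'
    Connected-cover conn m m' eq with image⇒ m m' eq
    ... | peq , meq with lift-moves m refl (conn (push m) (push m') peq)
    ...   | m'' , p , q , moves = moves ◅◅ same-push⇒moves m'' m' p (trans (sym q) meq)

-- Quadratic initial ideals and the lifted monomial order.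

module InitialIdeals where
  open Monomials
  open Covers
  open import Level using (Level; 0ℓ)
  open import Data.Bool using (Bool; true; false; if_then_else_)
  open import Data.Nat using (ℕ; zero; suc; _+_; _<_; z≤n; s≤s)
  import Data.Nat.Properties as ℕ
  open import Data.Fin using (Fin)
  import Data.Fin.Properties as Fin
  open import Data.Vec using (lookup)
  open import Data.Vec.Properties using (lookup-zipWith; lookup-replicate)
  open import Data.Product using (∃; ∃₂; _×_; _,_; proj₁; proj₂)
  open import Data.Product.Relation.Binary.Lex.Strict using (×-Lex; ×-wellFounded)
  open import Data.Sum using (_⊎_; inj₁; inj₂)
  open import Data.Empty using (⊥-elim)
  open import Relation.Nullary using (¬_; yes; no; does)
  open import Relation.Binary using (Rel; IsStrictTotalOrder; Tri; tri<; tri≈; tri>)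
  open import Relation.Binary.Structures.Biased using (isStrictTotalOrderᶜ)
  open import Relation.Binary.PropositionalEquality
  import Relation.Binary.Construct.On as On
  open import Induction.WellFounded using (WellFounded)
  open import Function using (_∘_)
  open import Data.Bool.Properties using () renaming (_≟_ to _≟ᵇ_)
  open import Relation.Nullary.Decidable using (_×-dec_)

  private variable
    n N d e : ℕ

  module Parts {im : Mono n → Mono d} {im' : Mono N → Mono e} (C : Cover im im') where
    open Cover C

    partᵛ : Bool → Fin N → Mono n
    partᵛ b v = if does (marked v ≟ᵇ b) then δ (π v) else 1ₘ

    part : Bool → Mono N → Mono n
    part b = hom (lookup ∘ partᵛ b)

    part-δ· : ∀ b v m → part b (δ v ·ₘ m) ≡ partᵛ b v ·ₘ part b m
    part-δ· b = hom-δ· (partᵛ b)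

    part-δδ : ∀ b v w → part b (δ v ·ₘ δ w) ≡ partᵛ b v ·ₘ partᵛ b w
    part-δδ b = hom-δδ (partᵛ b)

    partᵛ-pos : ∀ v → 0 < lookup (partᵛ (marked v) v) (π v)
    partᵛ-pos v with marked v
    ... | true  = ℕ.≤-reflexive (sym (lookup-δ (π v)))
    ... | false = ℕ.≤-reflexive (sym (lookup-δ (π v)))

    partᵛ-pos⁻ : ∀ b v i → 0 < lookup (partᵛ b v) i → π v ≡ i × marked v ≡ b
    partᵛ-pos⁻ b v i p with marked v ≟ᵇ b
    ... | yes eq = lookup-δ⁻ (π v) i p , eq
    ... | no  _  = ⊥-elim (ℕ.n≮0 (subst (0 <_) (lookup-replicate i 0) p))

    partᵛ-own : ∀ v {b} → marked v ≡ b → partᵛ b v ≡ δ (π v)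
    partᵛ-own v {b} eq with marked v ≟ᵇ b
    ... | yes _ = refl
    ... | no ¬eq = ⊥-elim (¬eq eq)

    partᵛ-other : ∀ v {b b'} → marked v ≡ b → b ≢ b' → partᵛ b' v ≡ 1ₘ
    partᵛ-other v {b} {b'} eq b≢b' with marked v ≟ᵇ b'
    ... | yes eq' = ⊥-elim (b≢b' (trans (sym eq) eq'))
    ... | no _ = refl

    part-pair : ∀ v w → marked v ≡ true → marked w ≡ false → part true (δ v ·ₘ δ w) ≡ δ (π v)
    part-pair v w tv tw = trans (part-δδ true v w)
      (trans (cong₂ _·ₘ_ (partᵛ-own v tv) (partᵛ-other w tw (λ ()))) (·-identityʳ (δ (π v))))

    part-pull : ∀ b m i → 0 < lookup (part b m) i → ∃₂ λ v u → m ≡ δ v ·ₘ u × π v ≡ i × marked v ≡ b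
    part-pull b m i p with hom-pull (partᵛ b) m i p
    ... | v , u , eq , q = v , u , eq , partᵛ-pos⁻ b v i q

    partᵛ-split : ∀ v → δ (π v) ≡ partᵛ false v ·ₘ partᵛ true v
    partᵛ-split v with marked v
    ... | true  = sym (·-identityˡ (δ (π v)))
    ... | false = sym (·-identityʳ (δ (π v)))

    push-parts : ∀ m → push m ≡ part false m ·ₘ part true m
    push-parts = mono-rec _
      (trans (hom-1ₘ (lookup ∘ δ ∘ π)) (sym (trans (cong₂ _·ₘ_ (hom-1ₘ (lookup ∘ partᵛ false)) (hom-1ₘ (lookup ∘ partᵛ true))) (·-identityˡ 1ₘ))))
      λ v u ih → begin
        push (δ v ·ₘ u)                                                          ≡⟨ push-δ· v u ⟩
        δ (π v) ·ₘ push u                                                        ≡⟨ cong₂ _·ₘ_ (partᵛ-split v) ih ⟩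
        (partᵛ false v ·ₘ partᵛ true v) ·ₘ (part false u ·ₘ part true u)         ≡⟨ Mono·.interchange (partᵛ false v) (partᵛ true v) (part false u) (part true u) ⟩
        (partᵛ false v ·ₘ part false u) ·ₘ (partᵛ true v ·ₘ part true u)         ≡⟨ cong₂ _·ₘ_ (part-δ· false v u) (part-δ· true v u) ⟨
        part false (δ v ·ₘ u) ·ₘ part true (δ v ·ₘ u)                            ∎
      where open ≡-Reasoning

    degree-partᵛ : ∀ v → ⟨ (λ _ → 1) , partᵛ true v ⟩ ≡ mark v
    degree-partᵛ v with marked v
    ... | true  = ⟨⟩-δ (λ _ → 1) (π v)
    ... | false = ⟨⟩-1ₘ {n} (λ _ → 1)

    -- Every marked factor contributes one variable. Equal mark counts thus become equal degrees of
    -- marked parts, as `exchange` requires.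
    degree-part : ∀ m → degree (part true m) ≡ ⟨ mark , m ⟩
    degree-part m = trans (sym (degree-⟨⟩ (part true m))) (trans (⟨⟩-hom (λ _ → 1) (partᵛ true) m) (⟨⟩-cong degree-partᵛ m))

    part-δ·-pos : ∀ v u → 0 < lookup (part (marked v) (δ v ·ₘ u)) (π v)
    part-δ·-pos v u = subst (0 <_)
      (sym (trans (cong (λ a → lookup a (π v)) (part-δ· (marked v) v u)) (lookup-zipWith _+_ (π v) (partᵛ (marked v) v) _)))
      (ℕ.m≤n⇒m≤n+o _ (partᵛ-pos v))

    -- By `injective` a variable is determined by its place under `π` and its mark. So a factor `v`
    -- of `m` shows in `part (marked v)` and must be a factor of `m'` as well; it is cancelled.
    parts-injective : ∀ m m' → (∀ b → part b m ≡ part b m') → m ≡ m'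
    parts-injective = mono-rec _ base go
      where
      base : ∀ m' → (∀ b → part b 1ₘ ≡ part b m') → 1ₘ ≡ m'
      base m' eq with 1ₘ-or-split m'
      ... | inj₁ refl = refl
      ... | inj₂ (v , u , refl) = ⊥-elim (ℕ.n≮0 (subst (0 <_)
        (trans (cong (λ a → lookup a (π v)) (trans (sym (eq (marked v))) (hom-1ₘ (lookup ∘ partᵛ (marked v))))) (lookup-replicate (π v) 0))
        (part-δ·-pos v u)))
      go : ∀ v u → (∀ m' → (∀ b → part b u ≡ part b m') → u ≡ m') →
           ∀ m' → (∀ b → part b (δ v ·ₘ u) ≡ part b m') → δ v ·ₘ u ≡ m'
      go v u ih m' eq with part-pull (marked v) m' (π v) (subst (λ a → 0 < lookup a (π v)) (eq (marked v)) (part-δ·-pos v u))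
      ... | w , u' , refl , pw , tw with refl ← injective pw tw =
        cong (δ v ·ₘ_) (ih u' λ b → ·-cancelˡ (partᵛ b v) (trans (sym (part-δ· b v u)) (trans (eq b) (part-δ· b v u'))))

    -- `push` is the product of the two parts, so cancelling the marked one leaves the unmarked one.
    -- This makes the key of `liftOrder` injective.
    push-part-injective : ∀ m m' → push m ≡ push m' → part true m ≡ part true m' → m ≡ m'
    push-part-injective m m' p q = parts-injective m m' λ { true → q ; false → unmarked }
      where
      open ≡-Reasoning
      unmarked : part false m ≡ part false m'
      unmarked = ·-cancelˡ (part true m) (begin
        part true m ·ₘ part false m    ≡⟨ ·-comm (part true m) (part false m) ⟩
        part false m ·ₘ part true m    ≡⟨ push-parts m ⟨
        push m                         ≡⟨ p ⟩
        push m'                        ≡⟨ push-parts m' ⟩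
        part false m' ·ₘ part true m'  ≡⟨ cong (part false m' ·ₘ_) (sym q) ⟩
        part false m' ·ₘ part true m   ≡⟨ ·-comm (part false m') (part true m) ⟩
        part true m ·ₘ part false m'   ∎)

  module GB {c ℓ : Level} (K : Field c ℓ) where
    open Poly K using (MonomialOrder)

    record Reducible (O : MonomialOrder n) (im : Mono n → Mono d) (m : Mono n) : Set where
      constructor reducible
      open MonomialOrder O renaming (_<_ to _≺_)
      field
        {i j k l} : Fin n
        u         : Mono n
        factors   : m ≡ (δ i ·ₘ δ j) ·ₘ u
        same      : im (δ i ·ₘ δ j) ≡ im (δ k ·ₘ δ l)
        descends  : (δ k ·ₘ δ l) ≺ (δ i ·ₘ δ j)

    -- For a toric `im`, having a smaller monomial in the fibre is what makes `m` a leading monomial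
    -- of the ideal: one way by the binomial of the two, the other way by `cancelling`.
    QuadraticInitial : (Mono n → Mono d) → Set₁
    QuadraticInitial {n} im = ∃ λ (O : MonomialOrder n) → let open MonomialOrder O renaming (_<_ to _≺_) in
      ∀ m m' → im m ≡ im m' → m' ≺ m → Reducible O im m

    module Order {n} (O : MonomialOrder n) where
      open MonomialOrder O renaming (_<_ to _≺_) public
      open IsStrictTotalOrder isSTO public using (compare; irrefl; asym; _<?_) renaming (trans to ≺-trans)

      multˡ : ∀ {a b} m → a ≺ b → (m ·ₘ a) ≺ (m ·ₘ b)
      multˡ {a} {b} m p = subst₂ _≺_ (·-comm a m) (·-comm b m) (mult a b m p)

      ≺-cancelˡ : ∀ m {a b} → (m ·ₘ a) ≺ (m ·ₘ b) → a ≺ b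
      ≺-cancelˡ m {a} {b} p with compare a b
      ... | tri< q _ _    = q
      ... | tri≈ _ refl _ = ⊥-elim (irrefl refl p)
      ... | tri> _ _ q    = ⊥-elim (asym p (multˡ m q))

      lookup-mono : ∀ v {a b : Mono n} j → lookup b j < lookup a j → lookup (v ·ₘ b) j < lookup (v ·ₘ a) j
      lookup-mono v {a} {b} j p = subst₂ _<_ (sym (lookup-zipWith _+_ j v b)) (sym (lookup-zipWith _+_ j v a)) (ℕ.+-monoʳ-< (lookup v j) p)

      -- Excess of multiplicity is used instead of mere occurrence because it survives
      -- multiplication by a common factor.
      Exchange : Mono n → Mono n → Set
      Exchange b a = ∃₂ λ i j → lookup b i < lookup a i × lookup a j < lookup b j × δ j ≺ δ i

      -- After removal of common factors, if every variable of a were below every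
      -- variable of b, then multiplying these inequalities would give a ≺ b.
      exchange : ∀ a b → degree a ≡ degree b → b ≺ a → Exchange b a
      exchange a b = go (degree a) a b refl ∘ sym
        where
        compare-all : ∀ k a b → degree a ≡ k → degree b ≡ k →
                      (∀ i j → 0 < lookup a i → 0 < lookup b j → δ i ≺ δ j) → a ≡ b ⊎ a ≺ b
        compare-all zero a b da db h = inj₁ (trans (degree≡0 a da) (sym (degree≡0 b db)))
        compare-all (suc k) a b da db h with degree≡suc a da | degree≡suc b db
        ... | i , x , refl , dx | j , y , refl , dy
            with compare-all k x y dx dy (λ i' j' p q → h i' j' (grow i x i' p) (grow j y j' q))
                 | mult (δ i) (δ j) x (h i j (here i x) (here j y))
          where
          here : ∀ i x → 0 < lookup (δ i ·ₘ x) i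
          here i x = subst (0 <_) (sym (trans (lookup-zipWith _+_ i (δ i) x) (cong (_+ lookup x i) (lookup-δ i)))) (s≤s z≤n)
          grow : ∀ i x i' → 0 < lookup x i' → 0 < lookup (δ i ·ₘ x) i'
          grow i x i' p = subst (0 <_) (sym (lookup-zipWith _+_ i' (δ i) x)) (ℕ.m≤n⇒m≤o+n _ p)
        ... | inj₁ refl | q = inj₂ q
        ... | inj₂ p    | q = inj₂ (≺-trans q (multˡ (δ j) p))

        go : ∀ k a b → degree a ≡ k → degree b ≡ k → b ≺ a → Exchange b a
        go k a b da db p with Fin.any? (λ i → (0 ℕ.<? lookup a i) ×-dec (0 ℕ.<? lookup b i))
        go k a b da db p | yes (i , ai , bi) with split a i ai | split b i bi
        go zero    _ _ da db p | yes (i , ai , bi) | x , refl | y , refl with () ← trans (sym (degree-δ· i x)) da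
        go (suc k) _ _ da db p | yes (i , ai , bi) | x , refl | y , refl
          with go k x y (ℕ.suc-injective (trans (sym (degree-δ· i x)) da)) (ℕ.suc-injective (trans (sym (degree-δ· i y)) db)) (≺-cancelˡ (δ i) p)
        ... | i' , j' , hi , hj , q = i' , j' , lookup-mono (δ i) i' hi , lookup-mono (δ i) j' hj , q
        go k a b da db p | no disjoint
          with Fin.any? (λ i → Fin.any? (λ j → (0 ℕ.<? lookup a i) ×-dec (0 ℕ.<? lookup b j) ×-dec (δ j <? δ i)))
        -- The supports are disjoint here, so a variable occurring in one monomial exceeds its
        -- multiplicity in the other, which is zero.
        ... | yes (i , j , ai , bj , q) =
          i , j , subst (_< lookup a i) (sym (missing (λ bi → disjoint (i , ai , bi)))) ai
                , subst (_< lookup b j) (sym (missing (λ aj → disjoint (j , aj , bj)))) bj , q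
          where
          missing : ∀ {x} → ¬ (0 < x) → x ≡ 0
          missing h = ℕ.n≤0⇒n≡0 (ℕ.≮⇒≥ h)
        -- Without such a pair, totality puts every variable of `a` below every variable of `b`,
        -- since equality would be a shared variable.
        ... | no none with compare-all k a b da db below
          where
          below : ∀ i j → 0 < lookup a i → 0 < lookup b j → δ i ≺ δ j
          below i j ai bj with compare (δ i) (δ j)
          ... | tri< q _ _  = q
          ... | tri≈ _ eq _ with refl ← lookup-δ⁻ i j (subst (λ a → 0 < lookup a j) (sym eq) (ℕ.≤-reflexive (sym (lookup-δ j)))) =
            ⊥-elim (disjoint (i , ai , bj))
          ... | tri> _ _ q  = ⊥-elim (none (i , j , ai , bj , q))
        ...   | inj₁ refl = ⊥-elim (irrefl refl p)
        ...   | inj₂ q    = ⊥-elim (asym p q)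

    module _ {im : Mono n → Mono d} {im' : Mono N → Mono e} (C : Cover im im') where
      open Cover C
      open Parts C

      -- A lexicographic order pulled back along `key`: total because `key` is injective, well
      -- founded as a pullback of a lexicographic product, multiplicative because both components
      -- are homomorphisms.
      liftOrder : MonomialOrder n → MonomialOrder N
      liftOrder O = record { _<_ = _≺'_ ; isSTO = isSTO' ; wf = wf' ; mult = mult' }
        where
        open Order O
        _⊏_ : Rel (Mono n × Mono n) 0ℓ
        _⊏_ = ×-Lex _≡_ _≺_ _≺_
        key : Mono N → Mono n × Mono n
        key m = push m , part true m
        _≺'_ : Rel (Mono N) 0ℓ
        a ≺' b = key a ⊏ key b
        trans' : ∀ a b c → a ≺' b → b ≺' c → a ≺' c
        trans' a b c (inj₁ p)       (inj₁ q)       = inj₁ (≺-trans p q)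
        trans' a b c (inj₁ p)       (inj₂ (e , _)) = inj₁ (subst (push a ≺_) e p)
        trans' a b c (inj₂ (e , _)) (inj₁ q)       = inj₁ (subst (_≺ push c) (sym e) q)
        trans' a b c (inj₂ (e , p)) (inj₂ (f , q)) = inj₂ (trans e f , ≺-trans p q)
        irrefl' : ∀ a → ¬ (a ≺' a)
        irrefl' a (inj₁ p)       = irrefl refl p
        irrefl' a (inj₂ (_ , p)) = irrefl refl p
        lt : ∀ a b → a ≺' b → Tri (a ≺' b) (a ≡ b) (b ≺' a)
        lt a b p = tri< p (λ { refl → irrefl' a p }) (λ q → irrefl' a (trans' a b a p q))
        gt : ∀ a b → b ≺' a → Tri (a ≺' b) (a ≡ b) (b ≺' a)
        gt a b p = tri> (λ q → irrefl' a (trans' a b a q p)) (λ { refl → irrefl' a p }) p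
        compare' : ∀ a b → Tri (a ≺' b) (a ≡ b) (b ≺' a)
        compare' a b with compare (push a) (push b) | compare (part true a) (part true b)
        ... | tri< p _ _ | _           = lt a b (inj₁ p)
        ... | tri> _ _ p | _           = gt a b (inj₁ p)
        ... | tri≈ _ e _ | tri< p _ _  = lt a b (inj₂ (e , p))
        ... | tri≈ _ e _ | tri> _ _ p  = gt a b (inj₂ (sym e , p))
        ... | tri≈ _ e _ | tri≈ _ f _ with refl ← push-part-injective a b e f = tri≈ (irrefl' a) refl (irrefl' a)
        isSTO' : IsStrictTotalOrder _≡_ _≺'_
        isSTO' = isStrictTotalOrderᶜ record { isEquivalence = isEquivalence ; trans = λ {a} {b} {c} → trans' a b c ; compare = compare' }
        wf' : WellFounded _≺'_
        wf' = On.wellFounded key (×-wellFounded wf wf)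
        mult' : ∀ a b m → a ≺' b → (a ·ₘ m) ≺' (b ·ₘ m)
        mult' a b m (inj₁ p) = inj₁ (subst₂ _≺_ (sym (hom-· _ a m)) (sym (hom-· _ b m)) (mult _ _ (push m) p))
        mult' a b m (inj₂ (e , p)) = inj₂
          ( trans (hom-· _ a m) (trans (cong (_·ₘ push m) e) (sym (hom-· _ b m)))
          , subst₂ _≺_ (sym (hom-· _ a m)) (sym (hom-· _ b m)) (mult _ _ (part true m) p))

      -- If the pushes differ, reduce below and lift the relation. If they agree, `exchange`
      -- supplies a variable `i` marked more often in `m` than in `m'` and a smaller `j` marked less
      -- often; moving a mark from `i` to `j` keeps the push and lowers the marked part.
      QuadraticInitial-cover : QuadraticInitial im → QuadraticInitial im'
      QuadraticInitial-cover (O , reduce) = liftOrder O , reduce'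
        where
        open Order O
        reduce' : ∀ m m' → im' m ≡ im' m' → MonomialOrder._<_ (liftOrder O) m' m → Reducible (liftOrder O) im' m
        reduce' m m' eq (inj₁ p) with reduce (push m) (push m') (proj₁ (image⇒ m m' eq)) p
        ... | reducible {i} {j} {k} {l} u factors same descends with pull₂ i j u m factors
        ...   | v , w , x , refl , refl , refl , refl with lift-relation v w same
        ...     | v' , w' , refl , refl , _ , rel =
          reducible x refl rel (inj₁ (subst₂ _≺_ (sym (push-δδ v' w')) (sym (push-δδ v w)) descends))
        reduce' m m' eq (inj₂ (peq , p)) with exchange (part true m) (part true m')
          (trans (degree-part m) (trans (proj₂ (image⇒ m m' eq)) (sym (degree-part m')))) p
        ... | i , j , hi , hj , q
          with part-pull true m i (ℕ.≤-<-trans z≤n hi) | part-pull true m' j (ℕ.≤-<-trans z≤n hj)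
        ...   | v , u , refl , refl , tv | x , _ , _ , px , tx
          with part-pull false u j unmarked
          where
          open ≡-Reasoning
          sum-eq : lookup (part false (δ v ·ₘ u)) j + lookup (part true (δ v ·ₘ u)) j ≡ lookup (part false m') j + lookup (part true m') j
          sum-eq = begin
            lookup (part false (δ v ·ₘ u)) j + lookup (part true (δ v ·ₘ u)) j ≡⟨ lookup-zipWith _+_ j (part false (δ v ·ₘ u)) (part true (δ v ·ₘ u)) ⟨
            lookup (part false (δ v ·ₘ u) ·ₘ part true (δ v ·ₘ u)) j           ≡⟨ cong (λ a → lookup a j) (trans (sym (push-parts (δ v ·ₘ u))) (trans (sym peq) (push-parts m'))) ⟩
            lookup (part false m' ·ₘ part true m') j                           ≡⟨ lookup-zipWith _+_ j (part false m') (part true m') ⟩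
            lookup (part false m') j + lookup (part true m') j                 ∎
          -- Both monomials have the same total multiplicity at `j`, and `m` has fewer marked
          -- copies, so some copy in `m` is unmarked; it is a factor of `u` because `v` is marked.
          unmarked : 0 < lookup (part false u) j
          unmarked = subst (λ a → 0 < lookup a j)
            (trans (part-δ· false v u) (trans (cong (_·ₘ part false u) (partᵛ-other v tv (λ ()))) (·-identityˡ (part false u))))
            (ℕ.≰⇒> λ z → ℕ.<-irrefl sum-eq (ℕ.+-mono-≤-< (ℕ.≤-trans z z≤n) hj))
        ...   | w , y , refl , refl , tw
          -- A marked copy over `π w` exists because `m'` has the marked factor `x` over that
          -- variable.
          with lift (π w) true (λ _ → trans (cong D (sym px)) (markable tx)) | lift (π v) false (λ ())
        ...   | v' , pv' , tv' | w' , pw' , tw' =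
          reducible y (sym (·-assoc (δ v) (δ w) y))
            (swap {v} {w} {v'} {w'} (sym pw') (sym pv') (cong₂ (λ a b → bit a + bit b) (trans tv (sym tv')) (trans tw (sym tw'))))
            (inj₂ ( trans (push-δδ v' w') (trans (·-comm (δ (π v')) (δ (π w'))) (trans (cong₂ (λ i j → δ i ·ₘ δ j) pw' pv') (sym (push-δδ v w))))
                  , subst₂ _≺_ (trans (cong δ (sym pv')) (sym (part-pair v' w' tv' tw'))) (sym (part-pair v w tv tw)) q ))

-- Linear functionals on polynomials, ideal membership and reachability.

module Polynomials where
  open Monomials
  open Covers
  open import Level using (Level)
  open import Data.Bool using (Bool; true; false; if_then_else_; _∧_; not)
  open import Data.Nat as Nat using (ℕ)
  open import Data.Vec.Properties using (≡-dec)
  open import Data.List as L using (List; []; _∷_; _++_)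
  open import Data.List.Relation.Unary.All as All using (All; []; _∷_)
  import Data.List.Relation.Unary.All.Properties as All
  open import Data.List.Relation.Unary.Any using (here; there)
  open import Data.List.Membership.Propositional using (_∈_)
  open import Data.List.Membership.Propositional.Properties using (∈-map⁺)
  open import Data.Product using (_×_; _,_; proj₁; proj₂)
  open import Data.Sum using (_⊎_; inj₁; inj₂)
  open import Data.Empty using (⊥-elim)
  open import Relation.Nullary using (¬_; yes; no; Dec; does)
  open import Relation.Nullary.Decidable using (_×-dec_; _⊎-dec_)
  open import Relation.Binary.PropositionalEquality as ≡ using (_≡_; _≢_; refl; cong)
  open import Relation.Binary.Construct.Closure.ReflexiveTransitive using (ε; _◅◅_)
  open import Function using (_∘_)

  private variable
    n d : ℕ

  _≟ₘ_ : (a b : Mono n) → Dec (a ≡ b)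
  _≟ₘ_ = ≡-dec Nat._≟_

  module Sums {c ℓ : Level} (K : Field c ℓ) where
    open Field K hiding (refl)
    open Poly K
    open import Algebra.Properties.CommutativeSemigroup +-commutativeSemigroup using (x∙yz≈y∙xz)
    open import Algebra.Properties.Ring ring using (-0#≈0#)
    module ≈ = Field K
    open import Relation.Binary.Reasoning.Setoid setoid

    -- A linear functional evaluated on unreduced term lists. The indicator of a monomial gives
    -- `coeff`, that of a fibre gives a coefficient of `φ`, and that of a component of moves detects
    -- connectedness.
    total : (Mono n → Bool) → Pol n → Carrier
    total w []            = 0#
    total w ((a , u) ∷ p) = (if w u then a else 0#) + total w p

    coeff-total : (p : Pol n) (m : Mono n) → coeff p m ≈ total (λ u → does (u ≟ₘ m)) p
    coeff-total []            m = ≈.refl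
    coeff-total ((a , u) ∷ p) m with u ≟ₘ m
    ... | yes _ = +-congˡ (coeff-total p m)
    ... | no  _ = trans (coeff-total p m) (sym (+-identityˡ _))

    total-++ : (w : Mono n → Bool) (p q : Pol n) → total w (p ++ q) ≈ total w p + total w q
    total-++ w []            q = sym (+-identityˡ _)
    total-++ w ((a , u) ∷ p) q = trans (+-congˡ (total-++ w p q)) (sym (+-assoc _ _ _))

    coeff-++ : (p q : Pol n) (m : Mono n) → coeff (p ++ q) m ≈ coeff p m + coeff q m
    coeff-++ p q m = begin
      coeff (p ++ q) m                                                     ≈⟨ coeff-total (p ++ q) m ⟩
      total (λ u → does (u ≟ₘ m)) (p ++ q)                                 ≈⟨ total-++ _ p q ⟩
      total (λ u → does (u ≟ₘ m)) p + total (λ u → does (u ≟ₘ m)) q        ≈⟨ +-cong (coeff-total p m) (coeff-total q m) ⟨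
      coeff p m + coeff q m                                                ∎

    total-map : (w : Mono d → Bool) (f : Mono n → Mono d) (p : Pol n) →
                total w (L.map (λ t → proj₁ t , f (proj₂ t)) p) ≡ total (w ∘ f) p
    total-map w f []      = refl
    total-map w f (t ∷ p) = cong (_ +_) (total-map w f p)

    total-off : (w : Mono n → Bool) (p : Pol n) → All (λ t → w (proj₂ t) ≡ false) p → total w p ≈ 0#
    total-off w []            []      = ≈.refl
    total-off w ((a , u) ∷ p) (h ∷ hs) rewrite h = trans (+-identityˡ _) (total-off w p hs)

    -- Terms at `m` scattered through `p` are gathered into one coefficient; this links termwise
    -- sums with the coefficientwise equality `≃`.
    total-peel : (w : Mono n → Bool) (m : Mono n) (p : Pol n) →
                 total w p ≈ total (λ u → w u ∧ not (does (u ≟ₘ m))) p + (if w m then coeff p m else 0#)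
    total-peel w m [] with w m
    ... | true  = sym (+-identityˡ 0#)
    ... | false = sym (+-identityˡ 0#)
    total-peel w m ((a , u) ∷ p) with u ≟ₘ m
    ... | no _ with w u
    ...   | true  = trans (+-congˡ (total-peel w m p)) (sym (+-assoc _ _ _))
    ...   | false = trans (+-congˡ (total-peel w m p)) (sym (+-assoc _ _ _))
    total-peel w m ((a , u) ∷ p) | yes refl with w u | total-peel w m p
    ...   | true  | ih = begin
      a + total w p                               ≈⟨ +-congˡ ih ⟩
      a + (_ + coeff p m)                         ≈⟨ x∙yz≈y∙xz _ _ _ ⟩
      _ + (a + coeff p m)                         ≈⟨ +-congʳ (+-identityˡ _) ⟨
      (0# + _) + (a + coeff p m)                  ∎
    ...   | false | ih = trans (+-congˡ ih) (sym (+-assoc _ _ _))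

    -- The finite list `q` covers the selected monomials of `p`. Peeling off its entries removes
    -- only zero coefficients, until nothing is selected.
    total-vanish : (q : List (Mono n)) (w : Mono n → Bool) (p : Pol n) →
                   All (λ t → w (proj₂ t) ≡ true → proj₂ t ∈ q) p →
                   All (λ u → w u ≡ true → coeff p u ≈ 0#) q → total w p ≈ 0#
    total-vanish [] w p cover _ = total-off w p (All.map off cover)
      where
      off : ∀ {u} → (w u ≡ true → u ∈ []) → w u ≡ false
      off {u} h with w u
      ... | false = refl
      ... | true with () ← h refl
    total-vanish (m ∷ q) w p cover (z ∷ zs) = begin
      total w p                                                                  ≈⟨ total-peel w m p ⟩
      total w' p + (if w m then coeff p m else 0#)                               ≈⟨ +-cong (total-vanish q w' p (All.map cover' cover) (All.map zs' zs)) last ⟩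
      0# + 0#                                                                    ≈⟨ +-identityˡ 0# ⟩
      0#                                                                         ∎
      where
      w' : Mono _ → Bool
      w' u = w u ∧ not (does (u ≟ₘ m))
      last : (if w m then coeff p m else 0#) ≈ 0#
      last with w m
      ... | true  = z refl
      ... | false = ≈.refl
      cover' : ∀ {u} → (w u ≡ true → u ∈ m ∷ q) → w' u ≡ true → u ∈ q
      cover' {u} h h' with w u | u ≟ₘ m
      cover' h ()  | false | _
      cover' h ()  | true  | yes _
      cover' h _   | true  | no u≢m with h refl
      ... | here eq  = ⊥-elim (u≢m eq)
      ... | there u∈ = u∈
      zs' : ∀ {u} → (w u ≡ true → coeff p u ≈ 0#) → w' u ≡ true → coeff p u ≈ 0#
      zs' {u} h h' with w u
      zs' h h' | true = h refl
      zs' h () | false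

    monomials : Pol n → List (Mono n)
    monomials = L.map proj₂

    monomials-cover : (w : Mono n → Bool) (p : Pol n) → All (λ t → w (proj₂ t) ≡ true → proj₂ t ∈ monomials p) p
    monomials-cover w p = All.tabulate λ t∈ _ → ∈-map⁺ proj₂ t∈

    total-zero : (w : Mono n → Bool) (p : Pol n) → (∀ u → coeff p u ≈ 0#) → total w p ≈ 0#
    total-zero w p h = total-vanish (monomials p) w p (monomials-cover w p) (All.tabulate λ {u} _ _ → h u)

    negate : Pol n → Pol n
    negate = L.map λ t → - proj₁ t , proj₂ t

    total-negate : (w : Mono n → Bool) (p : Pol n) → total w (negate p) ≈ - total w p
    total-negate w [] = sym -0#≈0#
    total-negate w ((a , u) ∷ p) = trans (+-cong head (total-negate w p)) (-‿+-comm _ _)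
      where
      open import Algebra.Properties.Ring ring using (-‿+-comm)
      head : (if w u then - a else 0#) ≈ - (if w u then a else 0#)
      head with w u
      ... | true  = ≈.refl
      ... | false = sym -0#≈0#

    -- Lists equal under `≃` may differ termwise, so their difference is formed as a list; its
    -- coefficients vanish, hence so does every functional on it.
    total-≃ : (w : Mono n → Bool) (p q : Pol n) → p ≃ q → total w p ≈ total w q
    total-≃ w p q h = begin
      total w p                                   ≈⟨ +-identityʳ _ ⟨
      total w p + 0#                              ≈⟨ +-congˡ (-‿inverseˡ (total w q)) ⟨
      total w p + (- total w q + total w q)       ≈⟨ +-assoc _ _ _ ⟨
      (total w p + - total w q) + total w q       ≈⟨ +-congʳ (+-congˡ (total-negate w q)) ⟨
      (total w p + total w (negate q)) + total w q ≈⟨ +-congʳ (total-++ w p (negate q)) ⟨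
      total w (p ++ negate q) + total w q         ≈⟨ +-congʳ (total-zero w (p ++ negate q) diff) ⟩
      0# + total w q                              ≈⟨ +-identityˡ _ ⟩
      total w q                                   ∎
      where
      diff : ∀ u → coeff (p ++ negate q) u ≈ 0#
      diff u = begin
        coeff (p ++ negate q) u                      ≈⟨ coeff-++ p (negate q) u ⟩
        coeff p u + coeff (negate q) u               ≈⟨ +-cong (h u) (trans (coeff-total (negate q) u) (trans (total-negate _ q) (-‿cong (sym (coeff-total q u))))) ⟩
        coeff q u + - coeff q u                      ≈⟨ -‿inverseʳ _ ⟩
        0#                                           ∎

    -1≉0 : ¬ (- 1# ≈ 0#)
    -1≉0 h = 1≉0 (begin
      1#          ≈⟨ +-identityʳ 1# ⟨
      1# + 0#     ≈⟨ +-congˡ h ⟨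
      1# + - 1#   ≈⟨ -‿inverseʳ 1# ⟩
      0#          ∎)

    total-binomial : (w : Mono n → Bool) {a b : Mono n} → w a ≡ w b → total w (binomial a b) ≈ 0#
    total-binomial w {a} {b} eq rewrite eq with w b
    ... | true  = trans (+-congˡ (+-identityʳ _)) (-‿inverseʳ 1#)
    ... | false = trans (+-identityˡ _) (+-identityˡ _)

    coeff-binomial-fst : {a b : Mono n} → a ≢ b → coeff (binomial a b) a ≈ 1#
    coeff-binomial-fst {a = a} {b} a≢b with a ≟ₘ a
    ... | no h = ⊥-elim (h refl)
    ... | yes _ with b ≟ₘ a
    ...   | yes b≡a = ⊥-elim (a≢b (≡.sym b≡a))
    ...   | no _    = +-identityʳ 1#

    coeff-binomial-snd : {a b : Mono n} → a ≢ b → coeff (binomial a b) b ≈ - 1#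
    coeff-binomial-snd {a = a} {b} a≢b with a ≟ₘ b
    ... | yes h = ⊥-elim (a≢b h)
    ... | no _ with b ≟ₘ b
    ...   | no h  = ⊥-elim (h refl)
    ...   | yes _ = +-identityʳ (- 1#)

    coeff-binomial-support : {a b m : Mono n} → ¬ (coeff (binomial a b) m ≈ 0#) → m ≡ a ⊎ m ≡ b
    coeff-binomial-support {a = a} {b} {m} h with a ≟ₘ m
    ... | yes a≡m = inj₁ (≡.sym a≡m)
    ... | no _ with b ≟ₘ m
    ...   | yes b≡m = inj₂ (≡.sym b≡m)
    ...   | no _    = ⊥-elim (h ≈.refl)

    binomial-refl : (a m : Mono n) → coeff (binomial a a) m ≈ 0#
    binomial-refl a m = trans (coeff-total (binomial a a) m) (total-binomial (λ u → does (u ≟ₘ m)) {a} {a} refl)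

    -- The two products coming from one term of `h` are selected together or not at all, and their
    -- coefficients cancel.
    total-⊗-binomial : (w : Mono n → Bool) (h : Pol n) (a b : Mono n) →
                       All (λ t → w (proj₂ t ·ₘ a) ≡ w (proj₂ t ·ₘ b)) h → total w (h ⊗ binomial a b) ≈ 0#
    total-⊗-binomial w []            a b []       = ≈.refl
    total-⊗-binomial w ((c , u) ∷ h) a b (eq ∷ eqs) rewrite eq = trans (sym (+-assoc _ _ _)) (trans (+-cong cancel (total-⊗-binomial w h a b eqs)) (+-identityˡ 0#))
      where
      cancel : (if w (u ·ₘ b) then c * 1# else 0#) + (if w (u ·ₘ b) then c * - 1# else 0#) ≈ 0#
      cancel with w (u ·ₘ b)
      ... | false = +-identityˡ 0#
      ... | true  = trans (sym (distribˡ c 1# (- 1#))) (trans (*-congˡ (-‿inverseʳ 1#)) (zeroʳ c))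

    Combination : List (Pol n × Pol n) → Pol n
    Combination = L.foldr (λ hg acc → (proj₁ hg ⊗ proj₂ hg) ⊕ acc) []

    diff : Carrier → Mono n → Mono n → Pol n
    diff c p q = (c , p) ∷ (- c , q) ∷ []

    total-diff : (w : Mono n → Bool) (c : Carrier) (p q : Mono n) →
                 total w (diff c p q) ≈ (if w p then c else 0#) - (if w q then c else 0#)
    total-diff w c p q = +-congˡ (trans (+-identityʳ _) neg)
      where
      neg : (if w q then - c else 0#) ≈ - (if w q then c else 0#)
      neg with w q
      ... | true  = ≈.refl
      ... | false = sym -0#≈0#

    -- Telescoping: the middle monomial is inserted with opposite signs.
    total-diff-trans : (w : Mono n → Bool) (c : Carrier) (p q r : Mono n) →
                       total w (diff c p r) ≈ total w (diff c p q) + total w (diff c q r)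
    total-diff-trans w c p q r = begin
      total w (diff c p r)                           ≈⟨ total-diff w c p r ⟩
      P - R                                          ≈⟨ +-congˡ (+-identityˡ _) ⟨
      P + (0# - R)                                   ≈⟨ +-congˡ (+-congʳ (-‿inverseˡ Q)) ⟨
      P + ((- Q + Q) - R)                            ≈⟨ +-congˡ (+-assoc _ _ _) ⟩
      P + (- Q + (Q - R))                            ≈⟨ +-assoc _ _ _ ⟨
      (P - Q) + (Q - R)                              ≈⟨ +-cong (total-diff w c p q) (total-diff w c q r) ⟨
      total w (diff c p q) + total w (diff c q r)    ∎
      where
      P = if w p then c else 0#
      Q = if w q then c else 0#
      R = if w r then c else 0#

    ≃-by-total : (p q : Pol n) → (∀ w → total w p ≈ total w q) → p ≃ q
    ≃-by-total p q h m = trans (coeff-total p m) (trans (h _) (sym (coeff-total q m)))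

    total-Combination-++ : (w : Mono n → Bool) (hs hs' : List (Pol n × Pol n)) →
                           total w (Combination (hs ++ hs')) ≈ total w (Combination hs) + total w (Combination hs')
    total-Combination-++ w []             hs' = sym (+-identityˡ _)
    total-Combination-++ w ((h , g) ∷ hs) hs' = begin
      total w ((h ⊗ g) ++ Combination (hs ++ hs'))                                       ≈⟨ total-++ w (h ⊗ g) _ ⟩
      total w (h ⊗ g) + total w (Combination (hs ++ hs'))                                ≈⟨ +-congˡ (total-Combination-++ w hs hs') ⟩
      total w (h ⊗ g) + (total w (Combination hs) + total w (Combination hs'))           ≈⟨ +-assoc _ _ _ ⟨
      (total w (h ⊗ g) + total w (Combination hs)) + total w (Combination hs')           ≈⟨ +-congʳ (total-++ w (h ⊗ g) _) ⟨
      total w ((h ⊗ g) ++ Combination hs) + total w (Combination hs')                    ∎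

    module _ {G : List (Pol n)} where
      InIdeal-≃ : (f g : Pol n) → f ≃ g → InIdeal G g → InIdeal G f
      InIdeal-≃ f g f≃g (hs , hs∈ , g≃) = hs , hs∈ , λ m → trans (f≃g m) (g≃ m)

      InIdeal-[] : InIdeal G []
      InIdeal-[] = [] , [] , λ _ → ≈.refl

      InIdeal-++ : (f g : Pol n) → InIdeal G f → InIdeal G g → InIdeal G (f ++ g)
      InIdeal-++ f g (hs , hs∈ , f≃) (hs' , hs'∈ , g≃) = hs ++ hs' , All.++⁺ hs∈ hs'∈ , ≃-by-total (f ++ g) (Combination (hs ++ hs')) λ w → begin
        total w (f ++ g)                                                     ≈⟨ total-++ w f g ⟩
        total w f + total w g                                                ≈⟨ +-cong (total-≃ w f (Combination hs) f≃) (total-≃ w g (Combination hs') g≃) ⟩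
        total w (Combination hs) + total w (Combination hs')                 ≈⟨ total-Combination-++ w hs hs' ⟨
        total w (Combination (hs ++ hs'))                                    ∎

      InIdeal-multiple : (c : Carrier) (u a b : Mono n) → binomial a b ∈ G → InIdeal G (diff c (u ·ₘ a) (u ·ₘ b))
      InIdeal-multiple c u a b ab∈ =
        (((c , u) ∷ []) , binomial a b) ∷ [] , ab∈ ∷ [] ,
        ≃-by-total (diff c (u ·ₘ a) (u ·ₘ b)) (Combination ((((c , u) ∷ []) , binomial a b) ∷ [])) λ w →
        +-cong (if-cong (w (u ·ₘ a)) (sym (*-identityʳ c)))
          (+-congʳ (if-cong (w (u ·ₘ b)) (trans (-‿cong (sym (*-identityʳ c))) (-‿distribʳ-* c 1#))))
        where
        open import Algebra.Properties.Ring ring using (-‿distribʳ-*)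
        if-cong : ∀ b {x y} → x ≈ y → (if b then x else 0#) ≈ (if b then y else 0#)
        if-cong true  h = h
        if-cong false h = ≈.refl

  -- Reachability along finitely many edges is decidable, one edge at a time.
  Reach : List (Mono n × Mono n) → Mono n → Mono n → Set
  Reach []             x y = x ≡ y
  Reach ((p , q) ∷ es) x y = Reach es x y ⊎ (Reach es x p × Reach es q y) ⊎ (Reach es x q × Reach es p y)

  Reach? : (es : List (Mono n × Mono n)) (x y : Mono n) → Dec (Reach es x y)
  Reach? []             x y = x ≟ₘ y
  Reach? ((p , q) ∷ es) x y = Reach? es x y ⊎-dec ((Reach? es x p ×-dec Reach? es q y) ⊎-dec (Reach? es x q ×-dec Reach? es p y))

  Reach-refl : (es : List (Mono n × Mono n)) (x : Mono n) → Reach es x x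
  Reach-refl []       x = refl
  Reach-refl (_ ∷ es) x = inj₁ (Reach-refl es x)

  -- A path ending at the head edge is cut before its first passage through it and led to the other
  -- endpoint, across the edge if necessary. For a later edge only the last segment changes.
  Reach-edge : (es : List (Mono n × Mono n)) {p q : Mono n} → (p , q) ∈ es → ∀ x →
               (Reach es x p → Reach es x q) × (Reach es x q → Reach es x p)
  Reach-edge ((p , q) ∷ es) (here refl) x = forth , back
    where
    forth : Reach ((p , q) ∷ es) x p → Reach ((p , q) ∷ es) x q
    forth (inj₁ r)              = inj₂ (inj₁ (r , Reach-refl es q))
    forth (inj₂ (inj₁ (r , _))) = inj₂ (inj₁ (r , Reach-refl es q))
    forth (inj₂ (inj₂ (r , _))) = inj₁ r
    back : Reach ((p , q) ∷ es) x q → Reach ((p , q) ∷ es) x p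
    back (inj₁ r)              = inj₂ (inj₂ (r , Reach-refl es p))
    back (inj₂ (inj₁ (r , _))) = inj₁ r
    back (inj₂ (inj₂ (r , _))) = inj₂ (inj₂ (r , Reach-refl es p))
  Reach-edge ((p' , q') ∷ es) (there e∈) x = map (λ y → proj₁ (Reach-edge es e∈ y)) , map (λ y → proj₂ (Reach-edge es e∈ y))
    where
    map : ∀ {a b} → (∀ y → Reach es y a → Reach es y b) → Reach ((p' , q') ∷ es) x a → Reach ((p' , q') ∷ es) x b
    map f (inj₁ r)              = inj₁ (f x r)
    map f (inj₂ (inj₁ (r , s))) = inj₂ (inj₁ (r , f q' s))
    map f (inj₂ (inj₂ (r , s))) = inj₂ (inj₂ (r , f p' s))

  Reach⇒Moves : {im : Mono n → Mono d} (es : List (Mono n × Mono n)) → All (λ pq → Moves im (proj₁ pq) (proj₂ pq)) es →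
                ∀ {x y} → Reach es x y → Moves im x y
  Reach⇒Moves []       _        refl                  = ε
  Reach⇒Moves (_ ∷ es) (m ∷ ms) (inj₁ r)              = Reach⇒Moves es ms r
  Reach⇒Moves (_ ∷ es) (m ∷ ms) (inj₂ (inj₁ (r , s))) = Reach⇒Moves es ms r ◅◅ m ◅◅ Reach⇒Moves es ms s
  Reach⇒Moves (_ ∷ es) (m ∷ ms) (inj₂ (inj₂ (r , s))) = Reach⇒Moves es ms r ◅◅ Moves-sym m ◅◅ Reach⇒Moves es ms s

  Reach-does : (es : List (Mono n × Mono n)) {p q : Mono n} → (p , q) ∈ es → ∀ x → does (Reach? es x p) ≡ does (Reach? es x q)
  Reach-does es {p} {q} e∈ x with Reach? es x p | Reach? es x q
  ... | yes _ | yes _  = refl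
  ... | no  _ | no  _  = refl
  ... | yes r | no ¬r  = ⊥-elim (¬r (proj₁ (Reach-edge es e∈ x) r))
  ... | no ¬r | yes r  = ⊥-elim (¬r (proj₂ (Reach-edge es e∈ x) r))

-- Combinatorial criteria for quadratic generation and quadratic Gröbner bases.

module ToricIdeals where
  open Monomials
  open Covers
  open InitialIdeals
  open Polynomials
  open import Level using (Level)
  open import Data.Bool using (Bool; true; if_then_else_; _∧_; not)
  open import Data.Nat using (ℕ)
  open import Data.List as L using (List; []; _∷_; _++_)
  open import Data.List.Relation.Unary.All as All using (All; []; _∷_)
  import Data.List.Relation.Unary.All.Properties as All
  open import Data.List.Relation.Unary.Any as Any using (here; there)
  open import Data.List.Membership.Propositional using (_∈_)
  open import Data.List.Membership.Propositional.Properties using (∈-map⁺; ∈-map⁻)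
  open import Data.Product using (∃; _×_; _,_; proj₁; proj₂)
  open import Data.Sum using (_⊎_; inj₁; inj₂)
  open import Data.Empty using (⊥-elim)
  open import Relation.Nullary using (¬_; yes; no; Dec; does)
  open import Relation.Nullary.Decidable using (_×-dec_; dec-true; dec-false)
  open import Relation.Binary.PropositionalEquality as ≡ using (_≡_; _≢_; refl; cong; cong₂)
  open import Relation.Binary.Construct.Closure.ReflexiveTransitive using (ε; _◅_)
  open import Function using (_∘_)
  open import Data.List.Membership.Propositional.Properties using (∈-filter⁺; ∈-filter⁻; ∈-cartesianProduct⁺; ∈-cartesianProduct⁻; ∈-allFin)

  module ToricIdeal {c ℓ : Level} (K : Field c ℓ) {d : ℕ} (isB : BasisPred d) where
    open Field K hiding (refl)
    open Poly K
    open Toric isB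
    open ToricGB isB
    open Sums K
    open GB K

    φ-total : (w : Mono d → Bool) (f : Pol nvars) → total w (φ f) ≡ total (w ∘ image) f
    φ-total w f = total-map w image f

    binomial∈J : ∀ {a b} → image a ≡ image b → InJ (binomial a b)
    binomial∈J {a} {b} eq u =
      ≡.subst (λ v → coeff (binomial (image a) v) u ≈ 0#) eq (binomial-refl (image a) u)

    -- If the images differed, nothing would cancel the coefficient `1#` at `image a`.
    binomial∈J⁻ : ∀ {a b} → InJ (binomial a b) → image a ≡ image b
    binomial∈J⁻ {a} {b} h with image a ≟ₘ image b
    ... | yes eq = eq
    ... | no neq = ⊥-elim (1≉0 (trans (sym (coeff-binomial-fst neq)) (h (image a))))

    quadrics : List (Mono nvars)
    quadrics = L.map (λ ij → δ (proj₁ ij) ·ₘ δ (proj₂ ij)) (L.cartesianProduct (L.allFin nvars) (L.allFin nvars))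

    same? : (ab : Mono nvars × Mono nvars) → Dec (image (proj₁ ab) ≡ image (proj₂ ab))
    same? (a , b) = image a ≟ₘ image b

    -- Ordered pairs are kept, so every nontrivial relation is also listed with its leading monomial
    -- first, whatever the monomial order.
    relations : List (Mono nvars × Mono nvars)
    relations = L.filter same? (L.cartesianProduct quadrics quadrics)

    ∈-quadrics : ∀ i j → δ i ·ₘ δ j ∈ quadrics
    ∈-quadrics i j = ∈-map⁺ _ (∈-cartesianProduct⁺ (∈-allFin i) (∈-allFin j))

    degree-quadrics : ∀ {a} → a ∈ quadrics → degree a ≡ 2
    degree-quadrics a∈ with ∈-map⁻ _ a∈
    ... | (i , j) , _ , refl = degree-δδ i j

    ∈-relations : ∀ {i j k l} → image (δ i ·ₘ δ j) ≡ image (δ k ·ₘ δ l) → (δ i ·ₘ δ j , δ k ·ₘ δ l) ∈ relations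
    ∈-relations {i} {j} {k} {l} eq = ∈-filter⁺ same? (∈-cartesianProduct⁺ (∈-quadrics i j) (∈-quadrics k l)) eq

    relations-degree : All (λ ab → degree (proj₁ ab) ≡ 2 × degree (proj₂ ab) ≡ 2) relations
    relations-degree = All.tabulate λ ab∈ →
      let a∈ , b∈ = ∈-cartesianProduct⁻ quadrics quadrics (proj₁ (∈-filter⁻ same? ab∈))
      in degree-quadrics a∈ , degree-quadrics b∈

    relations∈J : All (λ ab → InJ (binomial (proj₁ ab) (proj₂ ab))) relations
    relations∈J = All.tabulate λ { {a , b} ab∈ → binomial∈J {a} {b} (proj₂ (∈-filter⁻ same? {xs = L.cartesianProduct quadrics quadrics} ab∈)) }

    binomials : List (Mono nvars × Mono nvars) → List (Pol nvars)
    binomials = L.map (λ ab → binomial (proj₁ ab) (proj₂ ab))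

    -- The first monomial of `f` over `v` represents the fibre. The default `1ₘ` is reached only if
    -- no term of `f` lies over `v`.
    representative : Pol nvars → Mono d → Mono nvars
    representative []            v = 1ₘ
    representative ((_ , u) ∷ f) v with image u ≟ₘ v
    ... | yes _ = u
    ... | no  _ = representative f v

    image-representative : ∀ f {t} → t ∈ f → image (representative f (image (proj₂ t))) ≡ image (proj₂ t)
    image-representative ((_ , u) ∷ f) {_ , v} t∈ with image u ≟ₘ image v
    ... | yes eq = eq
    image-representative (_ ∷ f) (here refl) | no neq = ⊥-elim (neq refl)
    image-representative (_ ∷ f) (there t∈)  | no _   = image-representative f t∈

    -- The difference of the endpoints telescopes along the path, each move giving a multiple of one
    -- binomial of `relations`.
    moves⇒ideal : ∀ a {p q} → Moves image p q → InIdeal (binomials relations) (diff a p q)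
    moves⇒ideal a {p} ε = InIdeal-≃ (diff a p p) [] (≃-by-total (diff a p p) [] λ w → trans (total-diff w a p p) (-‿inverseʳ _)) InIdeal-[]
    moves⇒ideal a {p} {r} (step {i} {j} {k} {l} u refl refl same ◅ ms) =
      InIdeal-≃ (diff a p r) (diff a p q ++ diff a q r)
        (≃-by-total (diff a p r) (diff a p q ++ diff a q r) λ w →
          trans (total-diff-trans w a p q r) (sym (total-++ w (diff a p q) (diff a q r))))
        (InIdeal-++ (diff a p q) (diff a q r)
          (≡.subst₂ (λ s t → InIdeal (binomials relations) (diff a s t)) (·-comm u (δ i ·ₘ δ j)) (·-comm u (δ k ·ₘ δ l))
            (InIdeal-multiple a u (δ i ·ₘ δ j) (δ k ·ₘ δ l) (∈-map⁺ _ (∈-relations {i} {j} {k} {l} same))))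
          (moves⇒ideal a ms))
      where
      q : Mono nvars
      q = (δ k ·ₘ δ l) ·ₘ u

    module _ (r : Mono nvars → Mono nvars) where
      diffs : Pol nvars → Pol nvars
      diffs []            = []
      diffs ((a , u) ∷ f) = diff a u (r u) ++ diffs f

      total-diffs : ∀ w f → total w (diffs f) + total (w ∘ r) f ≈ total w f
      total-diffs w [] = +-identityˡ 0#
      total-diffs w ((a , u) ∷ f) = begin
        total w (diff a u (r u) ++ diffs f) + (R + total (w ∘ r) f)           ≈⟨ +-congʳ (total-++ w (diff a u (r u)) (diffs f)) ⟩
        (total w (diff a u (r u)) + total w (diffs f)) + (R + total (w ∘ r) f) ≈⟨ interchange _ _ _ _ ⟩
        (total w (diff a u (r u)) + R) + (total w (diffs f) + total (w ∘ r) f) ≈⟨ +-cong (+-congʳ (total-diff w a u (r u))) (total-diffs w f) ⟩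
        ((U - R) + R) + total w f                                             ≈⟨ +-congʳ (+-assoc U (- R) R) ⟩
        (U + (- R + R)) + total w f                                           ≈⟨ +-congʳ (+-congˡ (-‿inverseˡ R)) ⟩
        (U + 0#) + total w f                                                  ≈⟨ +-congʳ (+-identityʳ U) ⟩
        U + total w f                                                         ∎
        where
        open import Relation.Binary.Reasoning.Setoid setoid
        open import Algebra.Properties.CommutativeSemigroup +-commutativeSemigroup using (interchange)
        U = if w u then a else 0#
        R = if w (r u) then a else 0#

      diffs∈ideal : ∀ f → All (λ t → Moves image (proj₂ t) (r (proj₂ t))) f → InIdeal (binomials relations) (diffs f)
      diffs∈ideal []            []       = InIdeal-[]
      diffs∈ideal ((a , u) ∷ f) (m ∷ ms) = InIdeal-++ (diff a u (r u)) (diffs f) (moves⇒ideal a m) (diffs∈ideal f ms)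

    -- Move every term of `f` to the representative of its fibre. The differences lie in the ideal
    -- by connectedness; what remains is weighed through `image` alone, hence by a functional of
    -- `φ f`, and vanishes.
    Connected⇒QuadGenerated : Connected image → QuadGenerated
    Connected⇒QuadGenerated conn = relations , relations-degree , relations∈J , λ f f∈J →
      let r = representative f ∘ image in
      InIdeal-≃ f (diffs r f) (≃-by-total f (diffs r f) λ w → begin
        total w f                                     ≈⟨ total-diffs r w f ⟨
        total w (diffs r f) + total (w ∘ r) f         ≈⟨ +-congˡ (trans (reflexive (≡.sym (φ-total (w ∘ representative f) f))) (total-zero _ (φ f) f∈J)) ⟩
        total w (diffs r f) + 0#                      ≈⟨ +-identityʳ _ ⟩
        total w (diffs r f)                           ∎)
      (diffs∈ideal r f (All.tabulate λ {t} t∈ → conn _ _ (≡.sym (image-representative f t∈))))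
      where open import Relation.Binary.Reasoning.Setoid setoid

    degree-2-moves : ∀ {a b} → degree a ≡ 2 → degree b ≡ 2 → image a ≡ image b → ∀ u → Step image (u ·ₘ a) (u ·ₘ b)
    degree-2-moves {a} {b} da db eq u with degree≡2 a da | degree≡2 b db
    ... | i , j , refl | k , l , refl = step u (·-comm u (δ i ·ₘ δ j)) (·-comm u (δ k ·ₘ δ l)) eq

    module _ (G : List (Mono nvars × Mono nvars))
             (quad : All (λ ab → degree (proj₁ ab) ≡ 2 × degree (proj₂ ab) ≡ 2) G)
             (G⊆J : All (λ ab → InJ (binomial (proj₁ ab) (proj₂ ab))) G) where

      -- A combination of the generators is annihilated by every functional
      -- that is constant along the finitely many moves it uses.
      moves-used : ∀ hs → All (λ hg → proj₂ hg ∈ binomials G) hs →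
        ∃ λ es → All (λ pq → Moves image (proj₁ pq) (proj₂ pq)) es ×
          (∀ w → All (λ pq → w (proj₁ pq) ≡ w (proj₂ pq)) es → total w (Combination hs) ≈ 0#)
      moves-used [] [] = [] , [] , λ _ _ → ≈.refl
      moves-used ((h , g) ∷ hs) (g∈ ∷ hs∈) with ∈-map⁻ _ g∈ | moves-used hs hs∈
      ... | (a , b) , ab∈ , refl | es , ms , kill = L.map edge h ++ es , All.++⁺ (All.map⁺ (All.tabulate λ {t} _ → move t)) ms ,
        λ w inv → trans (total-++ w (h ⊗ binomial a b) (Combination hs))
          (trans (+-cong (total-⊗-binomial w h a b (All.map⁻ (All.++⁻ˡ (L.map edge h) inv))) (kill w (All.++⁻ʳ (L.map edge h) inv))) (+-identityˡ 0#))
        where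
        edge : Carrier × Mono nvars → Mono nvars × Mono nvars
        edge t = proj₂ t ·ₘ a , proj₂ t ·ₘ b
        move : ∀ t → Moves image (proj₂ t ·ₘ a) (proj₂ t ·ₘ b)
        move (_ , u) = degree-2-moves (proj₁ (All.lookup quad ab∈)) (proj₂ (All.lookup quad ab∈))
                         (binomial∈J⁻ {a} {b} (All.lookup G⊆J ab∈)) u ◅ ε

    -- Write the binomial of `m` and `m'` as a combination of generators and let `w` be the
    -- component of `m` under the finitely many moves used. Its functional kills the combination,
    -- but would be `1#` on the binomial if `m'` lay outside.
    QuadGenerated⇒Connected : QuadGenerated → Connected image
    QuadGenerated⇒Connected (G , quad , G⊆J , gen) m m' eq with gen (binomial m m') (binomial∈J {m} {m'} eq)
    ... | hs , hs∈ , m≃ with moves-used G quad G⊆J hs hs∈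
    ...   | es , ms , kill with Reach? es m m' in reach
    ...     | yes r = Reach⇒Moves es ms r
    ...     | no ¬r = ⊥-elim (1≉0 (begin
      1#                                ≈⟨ trans (+-congˡ (+-identityʳ 0#)) (+-identityʳ 1#) ⟨
      1# + (0# + 0#)                    ≡⟨ cong₂ (λ x y → (if x then 1# else 0#) + ((if y then - 1# else 0#) + 0#))
                                            (dec-true (Reach? es m m) (Reach-refl es m)) (dec-false (Reach? es m m') ¬r) ⟨
      total w (binomial m m')           ≈⟨ total-≃ w (binomial m m') (Combination hs) m≃ ⟩
      total w (Combination hs)          ≈⟨ kill w (All.tabulate λ {pq} e∈ → Reach-does es e∈ m) ⟩
      0#                                ∎))
      where
      open import Relation.Binary.Reasoning.Setoid setoid
      w : Mono nvars → Bool
      w x = does (Reach? es m x)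

    module _ (O : MonomialOrder nvars) where
      open Order O

      binomial-initial : ∀ {a b} → b ≺ a → IsInit O (binomial a b) a
      binomial-initial {a} {b} b≺a =
        (λ z → 1≉0 (trans (sym (coeff-binomial-fst {a = a} {b} a≢b)) z)) , below
        where
        a≢b : a ≢ b
        a≢b eq = irrefl (≡.sym eq) b≺a
        below : ∀ m → ¬ (coeff (binomial a b) m ≈ 0#) → (m ≺ a) ⊎ (m ≡ a)
        below m h with coeff-binomial-support {a = a} {b} {m} h
        ... | inj₁ refl = inj₂ refl
        ... | inj₂ refl = inj₁ b≺a

      binomial-initial⁻ : ∀ {a b m} → IsInit O (binomial a b) m → (m ≡ a × b ≺ a) ⊎ (m ≡ b × a ≺ b)
      binomial-initial⁻ {a} {b} {m} (nz , top) with a ≟ₘ b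
      ... | yes refl = ⊥-elim (nz (binomial-refl a m))
      ... | no a≢b with coeff-binomial-support {a = a} {b} {m} nz
      ...   | inj₁ refl with top b (λ z → -1≉0 (trans (sym (coeff-binomial-snd {a = a} {b} a≢b)) z))
      ...     | inj₁ lt = inj₁ (refl , lt)
      ...     | inj₂ eq = ⊥-elim (a≢b (≡.sym eq))
      binomial-initial⁻ {a} {b} {m} (nz , top) | no a≢b | inj₂ refl
          with top a (λ z → 1≉0 (trans (sym (coeff-binomial-fst {a = a} {b} a≢b)) z))
      ...     | inj₁ lt = inj₂ (refl , lt)
      ...     | inj₂ eq = ⊥-elim (a≢b eq)

      -- Allows finitely many undecided equalities of coefficients to be assumed while an absurdity
      -- is derived.
      ¬¬-All : ∀ {a p} {A : Set a} {P : A → Set p} {xs : List A} → All (λ x → ¬ ¬ P x) xs → ¬ ¬ All P xs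
      ¬¬-All []       k = k []
      ¬¬-All (h ∷ hs) k = h λ px → ¬¬-All hs λ pxs → k (px ∷ pxs)

      -- The coefficients over the fibre of m sum to zero, so m cannot be alone
      -- in its fibre.  Equality in the field need not be decidable, but the
      -- search over the terms of f is.
      cancelling : ∀ f m → InJ f → IsInit O f m → ∃ λ m' → image m ≡ image m' × m' ≺ m
      cancelling f m f∈J (nz , top) with Any.any? (λ t → (image m ≟ₘ image (proj₂ t)) ×-dec (proj₂ t <? m)) f
      ... | yes found with Any.satisfied found
      ...   | (_ , m') , eq , lt = m' , eq , lt
      cancelling f m f∈J (nz , top) | no none = ⊥-elim (¬¬-All (All.tabulate vanishing) λ zeros → nz (begin
        coeff f m                                              ≡⟨ cong (λ b → if b then coeff f m else 0#) (dec-true (image m ≟ₘ image m) refl) ⟨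
        (if w m then coeff f m else 0#)                        ≈⟨ +-identityˡ _ ⟨
        0# + (if w m then coeff f m else 0#)                   ≈⟨ +-congʳ (total-vanish (monomials f) w' f (monomials-cover w' f) zeros) ⟨
        total w' f + (if w m then coeff f m else 0#)           ≈⟨ total-peel w m f ⟨
        total w f                                              ≡⟨ φ-total (λ v → does (v ≟ₘ image m)) f ⟨
        total (λ v → does (v ≟ₘ image m)) (φ f)                ≈⟨ total-zero _ (φ f) f∈J ⟩
        0#                                                     ∎))
        where
        open import Relation.Binary.Reasoning.Setoid setoid
        w w' : Mono nvars → Bool
        w  u = does (image u ≟ₘ image m)
        w' u = w u ∧ not (does (u ≟ₘ m))
        -- A nonzero coefficient at another `u` of the fibre would put `u` below `m` by `top`,
        -- against the failed search.
        vanishing : ∀ {u} → u ∈ monomials f → ¬ ¬ (w' u ≡ true → coeff f u ≈ 0#)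
        vanishing {u} u∈ k with image u ≟ₘ image m | u ≟ₘ m
        ... | no _   | _       = k λ ()
        ... | yes _  | yes _   = k λ ()
        ... | yes eq | no u≢m with top u (λ z → k λ _ → z) | ∈-map⁻ proj₂ u∈
        ...   | inj₂ u≡m | _             = u≢m u≡m
        ...   | inj₁ lt  | t , t∈ , refl = none (Any.map (λ { refl → ≡.sym eq , lt }) t∈)

    -- By `cancelling`, a leading monomial has a smaller companion in its fibre, so `reduce`
    -- supplies the dividing quadric.
    QuadraticInitial⇒QuadGroebner : QuadraticInitial image → QuadGroebner
    QuadraticInitial⇒QuadGroebner (O , reduce) = O , relations , relations-degree , All.map⁺ relations∈J , divides
      where
      divides : ∀ f m → InJ f → IsInit O f m → ∃ λ g → g ∈ binomials relations × ∃ λ mg → IsInit O g mg × mg ∣ₘ m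
      divides f m f∈J init with cancelling O f m f∈J init
      ... | m' , eq , lt with reduce m m' eq lt
      ...   | reducible {i} {j} {k} {l} u refl same desc =
        binomial (δ i ·ₘ δ j) (δ k ·ₘ δ l) , ∈-map⁺ _ (∈-relations {i} {j} {k} {l} same) , δ i ·ₘ δ j ,
        binomial-initial O {δ i ·ₘ δ j} {δ k ·ₘ δ l} desc , ·⇒∣ₘ (δ i ·ₘ δ j) u

    -- The Gröbner property is applied to the binomial of `m` and `m'`, whose leading monomial is
    -- `m`. The basis element found may lead with either of its monomials, hence the two cases.
    QuadGroebner⇒QuadraticInitial : QuadGroebner → QuadraticInitial image
    QuadGroebner⇒QuadraticInitial (O , G , quad , G⊆J , lead) = O , reduce
      where
      open Order O

      reducible-by : ∀ {m a b} → degree a ≡ 2 → degree b ≡ 2 → image a ≡ image b → b ≺ a → a ∣ₘ m → Reducible O image m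
      reducible-by {m} {a} {b} da db eq lt a∣m with degree≡2 a da | degree≡2 b db | ∣ₘ⇒· {a = a} {m} a∣m
      ... | i , j , refl | k , l , refl | u , factors = reducible u factors eq lt

      reduce : ∀ m m' → image m ≡ image m' → m' ≺ m → Reducible O image m
      reduce m m' eq lt with lead (binomial m m') m (binomial∈J {m} {m'} eq) (binomial-initial O {m} {m'} lt)
      ... | g , g∈ , mg , init , mg∣m with ∈-map⁻ _ g∈
      ...   | (a , b) , ab∈ , refl with All.lookup quad ab∈ | binomial∈J⁻ {a} {b} (All.lookup (All.map⁻ G⊆J) ab∈) | binomial-initial⁻ O {a} {b} {mg} init
      ...     | da , db | same | inj₁ (refl , b≺a) = reducible-by da db same b≺a mg∣m
      ...     | da , db | same | inj₂ (refl , a≺b) = reducible-by db da (≡.sym same) a≺b mg∣m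

-- Bases of series and parallel extensions.

module Extensions where
  open Monomials
  open Covers
  open import Data.Bool using (Bool; true; false; if_then_else_; _∧_; not)
  open import Data.Bool.Properties using (not-involutive) renaming (_≟_ to _≟ᵇ_)
  open import Data.Nat using (ℕ; zero; suc; _+_; _*_; _≤_; z≤n; s≤s)
  import Data.Nat.Properties as ℕ
  open import Data.Fin using (Fin; zero; suc; inject₁; fromℕ)
  import Data.Fin.Properties as Fin
  open import Data.Fin.Relation.Unary.Top using (view; ‵fromℕ; ‵inject₁)
  open import Data.Vec as V using ([]; _∷_; lookup; _[_]≔_; _∷ʳ_; initLast)
  open import Data.Vec.Properties using (lookup-map; lookup∘update; lookup∘update′; map-[]≔; []≔-lookup; []≔-idempotent; init-∷ʳ; last-∷ʳ; map-∷ʳ; ∷ʳ-injective; map-∘; map-id; map-cong; lookup-zipWith; tabulate-cong)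
  open import Data.List as L using (List; []; _∷_)
  open import Data.List.Relation.Unary.All as All using ([]; _∷_)
  open import Data.List.Relation.Unary.AllPairs using (_∷_; [])
  open import Data.List.Relation.Unary.Any as Any using (here)
  open import Data.List.Relation.Unary.Any.Properties using (lookup-index)
  open import Data.List.Relation.Unary.Unique.Propositional using (Unique)
  import Data.List.Relation.Unary.Unique.Propositional.Properties as Unique
  open import Data.List.Membership.Propositional using (_∈_)
  open import Data.List.Membership.Propositional.Properties using (∈-map⁺; ∈-map⁻; ∈-++⁺ˡ; ∈-++⁺ʳ; ∈-filter⁺; ∈-filter⁻; ∈-lookup)
  open import Data.Product using (∃; ∃₂; _×_; _,_; proj₁; proj₂)
  open import Data.Empty using (⊥-elim)
  open import Relation.Nullary using (¬_; yes; no; does)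
  open import Relation.Nullary.Decidable using (_×-dec_; dec-true)
  open import Relation.Binary.PropositionalEquality
  open import Function using (_∘_)

  private variable
    d : ℕ

  ∈-allSubsets : (S : SubsetD d) → S ∈ allSubsets d
  ∈-allSubsets []          = here refl
  ∈-allSubsets (true ∷ S)  = ∈-++⁺ˡ (∈-map⁺ (true ∷_) (∈-allSubsets S))
  ∈-allSubsets (false ∷ S) = ∈-++⁺ʳ _ (∈-map⁺ (false ∷_) (∈-allSubsets S))

  allSubsets-unique : ∀ d → Unique (allSubsets d)
  allSubsets-unique zero    = [] ∷ []
  allSubsets-unique (suc d) = Unique.++⁺ (Unique.map⁺ (λ { refl → refl }) (allSubsets-unique d))
                                         (Unique.map⁺ (λ { refl → refl }) (allSubsets-unique d)) disjoint
    where
    disjoint : ∀ {S} → ¬ (S ∈ L.map (true ∷_) (allSubsets d) × S ∈ L.map (false ∷_) (allSubsets d))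
    disjoint (p , q) with ∈-map⁻ _ p | ∈-map⁻ _ q
    ... | _ , _ , refl | _ , _ , ()

  lookup-injective : ∀ {a} {A : Set a} {xs : List A} → Unique xs → ∀ i j → L.lookup xs i ≡ L.lookup xs j → i ≡ j
  lookup-injective (_ ∷ _)  zero    zero    _  = refl
  lookup-injective (x ∷ _)  zero    (suc j) eq = ⊥-elim (All.lookup x (∈-lookup j) eq)
  lookup-injective (x ∷ _)  (suc i) zero    eq = ⊥-elim (All.lookup x (∈-lookup i) (sym eq))
  lookup-injective (_ ∷ xs) (suc i) (suc j) eq = cong suc (lookup-injective xs i j eq)

  module Bases (isB : BasisPred d) where
    basis : Fin (L.length (bases isB)) → SubsetD d
    basis = L.lookup (bases isB)

    basis-isB : ∀ j → isB (basis j) ≡ true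
    basis-isB j = proj₂ (∈-filter⁻ (λ B → isB B ≟ᵇ true) {xs = allSubsets d} (∈-lookup j))

    basis-injective : ∀ {i j} → basis i ≡ basis j → i ≡ j
    basis-injective = lookup-injective (Unique.filter⁺ (λ B → isB B ≟ᵇ true) (allSubsets-unique d)) _ _

    index : ∀ B → isB B ≡ true → ∃ λ j → basis j ≡ B
    index B h = Any.index B∈ , sym (lookup-index B∈)
      where
      B∈ : B ∈ bases isB
      B∈ = ∈-filter⁺ (λ B → isB B ≟ᵇ true) (∈-allSubsets B) h

    χ : Fin d → Fin (L.length (bases isB)) → ℕ
    χ e j = bit (lookup (basis j) e)

    -- Definitionally the exponent map of the toric parametrisation, presented as a `hom`.
    image : Mono (L.length (bases isB)) → Mono d
    image = hom (λ j e → χ e j)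

    image-ext : ∀ m m' → (∀ e → ⟨ χ e , m ⟩ ≡ ⟨ χ e , m' ⟩) → image m ≡ image m'
    image-ext _ _ = tabulate-cong

    image-at : ∀ m m' → image m ≡ image m' → ∀ e → ⟨ χ e , m ⟩ ≡ ⟨ χ e , m' ⟩
    image-at m m' eq e = trans (sym (lookup-hom _ m e)) (trans (cong (λ a → lookup a e) eq) (lookup-hom _ m' e))

  -- Equicardinality of bases.

  card : SubsetD d → ℕ
  card B = degree (V.map bit B)

  card-clear : (B : SubsetD d) (x : Fin d) → lookup B x ≡ true → suc (card (B [ x ]≔ false)) ≡ card B
  card-clear (true ∷ B) zero    _ = refl
  card-clear (b ∷ B)    (suc x) h = trans (sym (ℕ.+-suc (bit b) _)) (cong (bit b +_) (card-clear B x h))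

  card-set : (B : SubsetD d) (x : Fin d) → lookup B x ≡ false → card (B [ x ]≔ true) ≡ suc (card B)
  card-set (false ∷ B) zero    _ = refl
  card-set (b ∷ B)     (suc x) h = trans (cong (bit b +_) (card-set B x h)) (ℕ.+-suc (bit b) _)

  card-∷ʳ : (B : SubsetD d) (b : Bool) → card (B ∷ʳ b) ≡ card B + bit b
  card-∷ʳ []      b = ℕ.+-identityʳ (bit b)
  card-∷ʳ (x ∷ B) b = trans (cong (bit x +_) (card-∷ʳ B b)) (sym (ℕ.+-assoc (bit x) _ _))

  card-⊆ : (A B : SubsetD d) → (∀ x → lookup A x ≡ true → lookup B x ≡ true) → card A ≤ card B
  card-⊆ []          []      h = z≤n
  card-⊆ (false ∷ A) (b ∷ B) h = ℕ.m≤n⇒m≤o+n (bit b) (card-⊆ A B (h ∘ suc))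
  card-⊆ (true ∷ A)  (b ∷ B) h with refl ← h zero refl = s≤s (card-⊆ A B (h ∘ suc))

  _∖_ : SubsetD d → SubsetD d → SubsetD d
  _∖_ = V.zipWith (λ a b → a ∧ not b)

  ∖-update : (A B : SubsetD d) (x : Fin d) (b : Bool) → (A [ x ]≔ b) ∖ B ≡ (A ∖ B) [ x ]≔ (b ∧ not (lookup B x))
  ∖-update (_ ∷ A) (_ ∷ B) zero    b = refl
  ∖-update (_ ∷ A) (_ ∷ B) (suc x) b = cong (_ ∷_) (∖-update A B x b)

  module Equicardinal {isB : BasisPred d} (M : IsMatroid isB) where
    open IsMatroid M

    -- Elements of `A` outside `B` are exchanged for elements of `B`. The cardinality stays, `A ∖ B`
    -- shrinks by one, and in the end `A` is contained in `B`.
    card≤ : ∀ A B → isB A ≡ true → isB B ≡ true → card A ≤ card B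
    card≤ A B hA hB = go (card (A ∖ B)) A refl hA
      where
      go : ∀ k A → card (A ∖ B) ≡ k → isB A ≡ true → card A ≤ card B
      go k A eq hA with Fin.any? (λ x → (lookup A x ≟ᵇ true) ×-dec (lookup B x ≟ᵇ false))
      ... | no none = card-⊆ A B sub
        where
        sub : ∀ x → lookup A x ≡ true → lookup B x ≡ true
        sub x ax with lookup B x in bx
        ... | true  = refl
        ... | false = ⊥-elim (none (x , ax , bx))
      ... | yes (x , ax , bx) with exchange A B hA hB x ax bx
      ...   | y , by , ay , hA' = descend k eq
        where
        A₁ = A [ x ]≔ false
        A₂ = A₁ [ y ]≔ true
        y≢x : y ≢ x
        y≢x refl with () ← trans (sym ax) ay
        a₁y : lookup A₁ y ≡ false
        a₁y = trans (lookup∘update′ y≢x A false) ay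
        card-A₂ : card A₂ ≡ card A
        card-A₂ = trans (card-set A₁ y a₁y) (card-clear A x ax)
        -- Adding `y` leaves the difference unchanged because `y` lies in `B`; deleting `x` removes
        -- exactly one element.
        diff-A₂ : suc (card (A₂ ∖ B)) ≡ card (A ∖ B)
        diff-A₂ = begin
          suc (card (A₂ ∖ B))                                        ≡⟨ cong (suc ∘ card) (∖-update A₁ B y true) ⟩
          suc (card ((A₁ ∖ B) [ y ]≔ not (lookup B y)))              ≡⟨ cong (λ b → suc (card ((A₁ ∖ B) [ y ]≔ b))) (trans (cong not by) (sym A₁∖B-y)) ⟩
          suc (card ((A₁ ∖ B) [ y ]≔ lookup (A₁ ∖ B) y))             ≡⟨ cong (suc ∘ card) ([]≔-lookup (A₁ ∖ B) y) ⟩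
          suc (card (A₁ ∖ B))                                        ≡⟨ cong (suc ∘ card) (∖-update A B x false) ⟩
          suc (card ((A ∖ B) [ x ]≔ false))                          ≡⟨ card-clear (A ∖ B) x (trans (lookup-zipWith _ x A B) (cong₂ (λ a b → a ∧ not b) ax bx)) ⟩
          card (A ∖ B)                                               ∎
          where
          open ≡-Reasoning
          A₁∖B-y : lookup (A₁ ∖ B) y ≡ false
          A₁∖B-y = trans (lookup-zipWith _ y A₁ B) (cong (_∧ not (lookup B y)) a₁y)
        descend : ∀ k → card (A ∖ B) ≡ k → card A ≤ card B
        descend zero    eq with () ← trans diff-A₂ eq
        descend (suc k) eq = subst (_≤ card B) card-A₂ (go k A₂ (ℕ.suc-injective (trans diff-A₂ eq)) hA')

    card≡ : ∀ {A B} → isB A ≡ true → isB B ≡ true → card A ≡ card B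
    card≡ {A} {B} hA hB = ℕ.≤-antisym (card≤ A B hA hB) (card≤ B A hB hA)

  lookup-∷ʳ-inject₁ : (B : SubsetD d) (b : Bool) (e : Fin d) → lookup (B ∷ʳ b) (inject₁ e) ≡ lookup B e
  lookup-∷ʳ-inject₁ (x ∷ B) b zero    = refl
  lookup-∷ʳ-inject₁ (x ∷ B) b (suc e) = lookup-∷ʳ-inject₁ B b e

  lookup-∷ʳ-fromℕ : (B : SubsetD d) (b : Bool) → lookup (B ∷ʳ b) (fromℕ d) ≡ b
  lookup-∷ʳ-fromℕ []      b = refl
  lookup-∷ʳ-fromℕ (x ∷ B) b = lookup-∷ʳ-fromℕ B b

  -- Series extension is the case β = true, parallel extension the case β = false.
  record IsExtension (β : Bool) (c : Fin d) (isB : BasisPred d) (isB' : BasisPred (suc d)) : Set where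
    field
      unmarked : ∀ A → isB' (A ∷ʳ β) ≡ isB A
      marked   : ∀ A → isB' (A ∷ʳ not β) ≡ does (lookup A c ≟ᵇ β) ∧ isB (A [ c ]≔ not β)

  -- On a basis with value `not β` at `c`, marking interchanges the values at `c` and at the new
  -- element.
  assemble : Bool → Fin d → Bool → SubsetD d → SubsetD (suc d)
  assemble β c false B = B ∷ʳ β
  assemble β c true  B = (B [ c ]≔ β) ∷ʳ not β

  ≢⇒not : ∀ {a b} → a ≢ b → a ≡ not b
  ≢⇒not {true}  {true}  h = ⊥-elim (h refl)
  ≢⇒not {true}  {false} h = refl
  ≢⇒not {false} {true}  h = refl
  ≢⇒not {false} {false} h = ⊥-elim (h refl)

  not≢ : ∀ {b} → b ≢ not b
  not≢ {true}  ()
  not≢ {false} ()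

  set-clear : (B : SubsetD d) (c : Fin d) (b b' : Bool) → lookup B c ≡ b' → (B [ c ]≔ b) [ c ]≔ b' ≡ B
  set-clear B c b b' refl = trans ([]≔-idempotent B c) ([]≔-lookup B c)

  -- The last coordinate reveals the mark. A mark overwrites coordinate `c`, but the hypothesis says
  -- what stood there, so `B` can be restored.
  assemble-injective : ∀ β (c : Fin d) b b' {B B'} → (b ≡ true → lookup B c ≡ not β) → (b' ≡ true → lookup B' c ≡ not β) →
                       assemble β c b B ≡ assemble β c b' B' → b ≡ b' × B ≡ B'
  assemble-injective β c false false h h' eq = refl , proj₁ (∷ʳ-injective _ _ eq)
  assemble-injective β c false true  h h' eq = ⊥-elim (not≢ (proj₂ (∷ʳ-injective _ _ eq)))
  assemble-injective β c true  false h h' eq = ⊥-elim (not≢ (sym (proj₂ (∷ʳ-injective _ _ eq))))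
  assemble-injective β c true  true {B} {B'} h h' eq = refl , (begin
    B                              ≡⟨ set-clear B c β (not β) (h refl) ⟨
    (B [ c ]≔ β) [ c ]≔ not β      ≡⟨ cong (_[ c ]≔ not β) (proj₁ (∷ʳ-injective _ _ eq)) ⟩
    (B' [ c ]≔ β) [ c ]≔ not β     ≡⟨ set-clear B' c β (not β) (h' refl) ⟩
    B'                             ∎)
    where open ≡-Reasoning

  module Extension {β : Bool} {c : Fin d} {isB : BasisPred d} {isB' : BasisPred (suc d)}
                   (ext : IsExtension β c isB isB') where
    open IsExtension ext
    module B  = Bases isB
    module B' = Bases isB'

    compose : ∀ b B → isB B ≡ true → (b ≡ true → lookup B c ≡ not β) → isB' (assemble β c b B) ≡ true
    compose false B hB _ = trans (unmarked B) hB
    compose true  B hB h = begin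
      isB' ((B [ c ]≔ β) ∷ʳ not β)                                             ≡⟨ marked (B [ c ]≔ β) ⟩
      does (lookup (B [ c ]≔ β) c ≟ᵇ β) ∧ isB ((B [ c ]≔ β) [ c ]≔ not β)      ≡⟨ cong₂ _∧_ (dec-true (lookup (B [ c ]≔ β) c ≟ᵇ β) (lookup∘update c B β)) (cong isB (set-clear B c β (not β) (h refl))) ⟩
      isB B                                                                    ≡⟨ hB ⟩
      true                                                                     ∎
      where open ≡-Reasoning

    decompose : ∀ S → isB' S ≡ true → ∃₂ λ b B → S ≡ assemble β c b B × isB B ≡ true × (b ≡ true → lookup B c ≡ not β)
    decompose S hS with initLast S
    ... | A , y , refl with y ≟ᵇ β
    ...   | yes refl = false , A , refl , trans (sym (unmarked A)) hS , λ ()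
    ...   | no y≢β with refl ← ≢⇒not y≢β with lookup A c ≟ᵇ β | trans (sym (marked A)) hS
    ...     | yes a≡β | hA = true , A [ c ]≔ not β , cong (_∷ʳ not β) (sym (set-clear A c (not β) β a≡β)) , hA , λ _ → lookup∘update c A (not β)
    ...     | no _    | ()

    parts : ∀ v → ∃₂ λ b B → B'.basis v ≡ assemble β c b B × isB B ≡ true × (b ≡ true → lookup B c ≡ not β)
    parts v = decompose (B'.basis v) (B'.basis-isB v)

    mark? : Fin _ → Bool
    mark? v = proj₁ (parts v)

    mark : Fin _ → ℕ
    mark = bit ∘ mark?

    π : Fin _ → Fin _
    π v = proj₁ (B.index (proj₁ (proj₂ (parts v))) (proj₁ (proj₂ (proj₂ (proj₂ (parts v))))))

    basis-π : ∀ v → B.basis (π v) ≡ proj₁ (proj₂ (parts v))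
    basis-π v = proj₂ (B.index (proj₁ (proj₂ (parts v))) (proj₁ (proj₂ (proj₂ (proj₂ (parts v))))))

    basis' : ∀ v → B'.basis v ≡ assemble β c (mark? v) (B.basis (π v))
    basis' v = trans (proj₁ (proj₂ (proj₂ (parts v)))) (cong (assemble β c (mark? v)) (sym (basis-π v)))

    markable : ∀ v → mark? v ≡ true → lookup (B.basis (π v)) c ≡ not β
    markable v h = trans (cong (λ B → lookup B c) (basis-π v)) (proj₂ (proj₂ (proj₂ (proj₂ (parts v)))) h)

    injective : ∀ {v w} → π v ≡ π w → mark? v ≡ mark? w → v ≡ w
    injective {v} {w} p q = B'.basis-injective (trans (basis' v) (trans (cong₂ (λ b i → assemble β c b (B.basis i)) q p) (sym (basis' w))))

    D : Fin _ → Bool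
    D i = does (lookup (B.basis i) c ≟ᵇ not β)

    D⇒ : ∀ i → D i ≡ true → lookup (B.basis i) c ≡ not β
    D⇒ i h with lookup (B.basis i) c ≟ᵇ not β
    ... | yes eq = eq
    D⇒ i () | no _

    lift : ∀ i b → (b ≡ true → D i ≡ true) → ∃ λ v → π v ≡ i × mark? v ≡ b
    lift i b h with B'.index (assemble β c b (B.basis i)) (compose b (B.basis i) (B.basis-isB i) (D⇒ i ∘ h))
    ... | v , eq with assemble-injective β c (mark? v) b (markable v) (D⇒ i ∘ h) (trans (sym (basis' v)) eq)
    ...   | q , p = v , B.basis-injective p , q

    push : Mono _ → Mono _
    push = hom (lookup ∘ δ ∘ π)

    ⟨⟩-push : ∀ w m → ⟨ w , push m ⟩ ≡ ⟨ w ∘ π , m ⟩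
    ⟨⟩-push w m = trans (⟨⟩-hom w (δ ∘ π) m) (⟨⟩-cong (λ v → ⟨⟩-δ w (π v)) m)

    χ-other : ∀ {e} → e ≢ c → ∀ v → B'.χ (inject₁ e) v ≡ B.χ e (π v)
    χ-other {e} e≢c v = cong bit (trans (cong (λ S → lookup S (inject₁ e)) (basis' v)) (at (mark? v)))
      where
      at : ∀ b → lookup (assemble β c b (B.basis (π v))) (inject₁ e) ≡ lookup (B.basis (π v)) e
      at false = lookup-∷ʳ-inject₁ (B.basis (π v)) β e
      at true  = trans (lookup-∷ʳ-inject₁ (B.basis (π v) [ c ]≔ β) (not β) e) (lookup∘update′ e≢c (B.basis (π v)) β)

    basis'-c : ∀ v → lookup (B'.basis v) (inject₁ c) ≡ (if mark? v then β else lookup (B.basis (π v)) c)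
    basis'-c v = trans (cong (λ S → lookup S (inject₁ c)) (basis' v)) (at (mark? v))
      where
      at : ∀ b → lookup (assemble β c b (B.basis (π v))) (inject₁ c) ≡ (if b then β else lookup (B.basis (π v)) c)
      at false = lookup-∷ʳ-inject₁ (B.basis (π v)) β c
      at true  = trans (lookup-∷ʳ-inject₁ (B.basis (π v) [ c ]≔ β) (not β) c) (lookup∘update c (B.basis (π v)) β)

    basis'-new : ∀ v → lookup (B'.basis v) (fromℕ d) ≡ (if mark? v then not β else β)
    basis'-new v = trans (cong (λ S → lookup S (fromℕ d)) (basis' v)) (at (mark? v))
      where
      at : ∀ b → lookup (assemble β c b (B.basis (π v))) (fromℕ d) ≡ (if b then not β else β)
      at false = lookup-∷ʳ-fromℕ (B.basis (π v)) β
      at true  = lookup-∷ʳ-fromℕ (B.basis (π v) [ c ]≔ β) (not β)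

    ⟨⟩-other : ∀ {e} → e ≢ c → ∀ m → ⟨ B'.χ (inject₁ e) , m ⟩ ≡ ⟨ B.χ e , push m ⟩
    ⟨⟩-other {e} e≢c m = trans (⟨⟩-cong (χ-other e≢c) m) (sym (⟨⟩-push (B.χ e) m))

    -- Marking affects only `c` and the new element; every other coordinate is that of the push.
    image-by-coordinates : ∀ m m' → ⟨ B'.χ (fromℕ d) , m ⟩ ≡ ⟨ B'.χ (fromℕ d) , m' ⟩ →
                           ⟨ B'.χ (inject₁ c) , m ⟩ ≡ ⟨ B'.χ (inject₁ c) , m' ⟩ →
                           B.image (push m) ≡ B.image (push m') → B'.image m ≡ B'.image m'
    image-by-coordinates m m' new atc old = B'.image-ext m m' go
      where
      go : ∀ e → ⟨ B'.χ e , m ⟩ ≡ ⟨ B'.χ e , m' ⟩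
      go e with view e
      ... | ‵fromℕ = new
      ... | ‵inject₁ i with i Fin.≟ c
      ...   | yes refl = atc
      ...   | no i≢c = trans (⟨⟩-other i≢c m) (trans (B.image-at (push m) (push m') old i) (sym (⟨⟩-other i≢c m')))

    push-image-by-coordinates : ∀ m m' → ⟨ B.χ c , push m ⟩ ≡ ⟨ B.χ c , push m' ⟩ →
                                B'.image m ≡ B'.image m' → B.image (push m) ≡ B.image (push m')
    push-image-by-coordinates m m' atc eq = B.image-ext (push m) (push m') go
      where
      go : ∀ e → ⟨ B.χ e , push m ⟩ ≡ ⟨ B.χ e , push m' ⟩
      go e with e Fin.≟ c
      ... | yes refl = atc
      ... | no e≢c = trans (sym (⟨⟩-other e≢c m)) (trans (B'.image-at m m' eq (inject₁ e)) (⟨⟩-other e≢c m'))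

    -- The degree premise holds automatically for two quadrics; the series case uses it to recover
    -- the new coordinate from the mark count.
    cover : (∀ m m' → B'.image m ≡ B'.image m' → B.image (push m) ≡ B.image (push m') × ⟨ mark , m ⟩ ≡ ⟨ mark , m' ⟩) →
            (∀ m m' → degree m ≡ degree m' → B.image (push m) ≡ B.image (push m') → ⟨ mark , m ⟩ ≡ ⟨ mark , m' ⟩ → B'.image m ≡ B'.image m') →
            (∀ {i j k l} → B.χ c i + B.χ c j ≡ B.χ c k + B.χ c l → bit (D i) + bit (D j) ≡ bit (D k) + bit (D l)) →
            Cover B.image B'.image
    cover image⇒ image⇐ D-count = record
      { π = π ; marked = mark? ; D = D ; injective = injective
      ; markable = λ {v} h → dec-true (lookup (B.basis (π v)) c ≟ᵇ not β) (markable v h)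
      ; lift = lift ; image⇒ = image⇒
      ; image⇐ = λ {v} {w} {v'} {w'} eq meq → image⇐ (δ v ·ₘ δ w) (δ v' ·ₘ δ w')
          (trans (degree-δδ v w) (sym (degree-δδ v' w')))
          (trans (cong B.image (hom-δδ (δ ∘ π) v w)) (trans eq (cong B.image (sym (hom-δδ (δ ∘ π) v' w')))))
          (trans (⟨⟩-δδ mark v w) (trans meq (sym (⟨⟩-δδ mark v' w'))))
      ; D-count = λ {i} {j} {k} {l} eq → D-count (trans (sym (⟨⟩-δδ (B.χ c) i j)) (trans (B.image-at (δ i ·ₘ δ j) (δ k ·ₘ δ l) eq c) (⟨⟩-δδ (B.χ c) k l)))
      }

  module Parallel {c : Fin d} {isB : BasisPred d} {isB' : BasisPred (suc d)} (ext : IsExtension false c isB isB') where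
    open Extension ext

    ⟨⟩-new : ∀ m → ⟨ B'.χ (fromℕ d) , m ⟩ ≡ ⟨ mark , m ⟩
    ⟨⟩-new = ⟨⟩-cong λ v → cong bit (trans (basis'-new v) (flip (mark? v)))
      where
      flip : ∀ b → (if b then true else false) ≡ b
      flip true  = refl
      flip false = refl

    -- A marked basis has lost `c`, which the basis below contains, so adding the marks restores the
    -- count below.
    ⟨⟩-c : ∀ m → ⟨ B'.χ (inject₁ c) , m ⟩ + ⟨ mark , m ⟩ ≡ ⟨ B.χ c , push m ⟩
    ⟨⟩-c m = trans (sym (⟨⟩-+ (B'.χ (inject₁ c)) mark m)) (trans (⟨⟩-cong at m) (sym (⟨⟩-push (B.χ c) m)))
      where
      at : ∀ v → B'.χ (inject₁ c) v + mark v ≡ B.χ c (π v)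
      at v rewrite basis'-c v with mark? v | markable v
      ... | true  | h rewrite h refl = refl
      ... | false | _ = ℕ.+-identityʳ _

    D≡χ : ∀ i → bit (D i) ≡ B.χ c i
    D≡χ i with lookup (B.basis i) c
    ... | true  = refl
    ... | false = refl

    -- `⟨⟩-new` reads the mark count off the image and `⟨⟩-c` then yields the old coordinate at `c`;
    -- both equations can be solved backwards.
    parallel-cover : Cover B.image B'.image
    parallel-cover = cover image⇒ image⇐ λ {i} {j} {k} {l} eq →
      trans (cong₂ _+_ (D≡χ i) (D≡χ j)) (trans eq (sym (cong₂ _+_ (D≡χ k) (D≡χ l))))
      where
      image⇒ : ∀ m m' → B'.image m ≡ B'.image m' → B.image (push m) ≡ B.image (push m') × ⟨ mark , m ⟩ ≡ ⟨ mark , m' ⟩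
      image⇒ m m' eq = push-image-by-coordinates m m'
        (trans (sym (⟨⟩-c m)) (trans (cong₂ _+_ (coord (inject₁ c)) meq) (⟨⟩-c m'))) eq , meq
        where
        coord = B'.image-at m m' eq
        meq : ⟨ mark , m ⟩ ≡ ⟨ mark , m' ⟩
        meq = trans (sym (⟨⟩-new m)) (trans (coord (fromℕ d)) (⟨⟩-new m'))
      image⇐ : ∀ m m' → degree m ≡ degree m' → B.image (push m) ≡ B.image (push m') → ⟨ mark , m ⟩ ≡ ⟨ mark , m' ⟩ → B'.image m ≡ B'.image m'
      image⇐ m m' _ eq meq = image-by-coordinates m m'
        (trans (⟨⟩-new m) (trans meq (sym (⟨⟩-new m'))))
        (ℕ.+-cancelʳ-≡ ⟨ mark , m ⟩ _ _ (trans (⟨⟩-c m) (trans (B.image-at (push m) (push m') eq c)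
          (trans (sym (⟨⟩-c m')) (cong (⟨ B'.χ (inject₁ c) , m' ⟩ +_) (sym meq)))))) eq

  module Series {c : Fin d} {isB : BasisPred d} {isB' : BasisPred (suc d)} (M : IsMatroid isB) (ext : IsExtension true c isB isB') where
    open Extension ext
    open IsMatroid M
    open Equicardinal M

    rank : ℕ
    rank = card (proj₁ nonempty)

    -- A basis of the series extension is marked exactly when it misses the new element.
    ⟨⟩-new : ∀ m → ⟨ B'.χ (fromℕ d) , m ⟩ + ⟨ mark , m ⟩ ≡ degree m
    ⟨⟩-new m = trans (sym (⟨⟩-+ (B'.χ (fromℕ d)) mark m)) (trans (⟨⟩-cong at m) (degree-⟨⟩ m))
      where
      at : ∀ v → B'.χ (fromℕ d) v + mark v ≡ 1
      at v rewrite basis'-new v with mark? v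
      ... | true  = refl
      ... | false = refl

    ⟨⟩-c : ∀ m → ⟨ B.χ c , push m ⟩ + ⟨ mark , m ⟩ ≡ ⟨ B'.χ (inject₁ c) , m ⟩
    ⟨⟩-c m = trans (cong (_+ ⟨ mark , m ⟩) (⟨⟩-push (B.χ c) m)) (trans (sym (⟨⟩-+ (B.χ c ∘ π) mark m)) (⟨⟩-cong at m))
      where
      at : ∀ v → B.χ c (π v) + mark v ≡ B'.χ (inject₁ c) v
      at v rewrite basis'-c v with mark? v | markable v
      ... | true  | h rewrite h refl = refl
      ... | false | _ = ℕ.+-identityʳ _

    χ+D : ∀ i → B.χ c i + bit (D i) ≡ 1
    χ+D i with lookup (B.basis i) c
    ... | true  = refl
    ... | false = refl

    card-assemble : ∀ b B → (b ≡ true → lookup B c ≡ false) → card (assemble true c b B) ≡ suc (card B)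
    card-assemble false B h = trans (card-∷ʳ B true) (ℕ.+-comm (card B) 1)
    card-assemble true  B h = trans (card-∷ʳ (B [ c ]≔ true) false) (trans (ℕ.+-identityʳ _) (card-set B c (h refl)))

    card-basis' : ∀ v → card (B'.basis v) ≡ suc rank
    card-basis' v = trans (cong card (basis' v)) (trans (card-assemble (mark? v) (B.basis (π v)) (markable v))
      (cong suc (card≡ (B.basis-isB (π v)) (proj₂ nonempty))))

    -- All bases of the extension have `suc rank` elements. As this is positive even in rank zero,
    -- the image determines the degree.
    degree-image : ∀ m → degree (B'.image m) ≡ degree m * suc rank
    degree-image m = begin
      degree (B'.image m)                                          ≡⟨ cong degree (tabulate-cong λ e → ⟨⟩-cong (λ v → lookup-map e bit (B'.basis v)) m) ⟨
      degree (hom (lookup ∘ V.map bit ∘ B'.basis) m)               ≡⟨ degree-⟨⟩ (hom (lookup ∘ V.map bit ∘ B'.basis) m) ⟨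
      ⟨ (λ _ → 1) , hom (lookup ∘ V.map bit ∘ B'.basis) m ⟩        ≡⟨ ⟨⟩-hom (λ _ → 1) (V.map bit ∘ B'.basis) m ⟩
      ⟨ (λ v → ⟨ (λ _ → 1) , V.map bit (B'.basis v) ⟩) , m ⟩       ≡⟨ ⟨⟩-cong (λ v → trans (degree-⟨⟩ (V.map bit (B'.basis v))) (card-basis' v)) m ⟩
      ⟨ (λ _ → suc rank) , m ⟩                                     ≡⟨ ⟨⟩-const (suc rank) m ⟩
      degree m * suc rank                                          ∎
      where open ≡-Reasoning

    series-cover : Cover B.image B'.image
    series-cover = cover image⇒ image⇐ λ {i} {j} {k} {l} eq →
      ℕ.+-cancelˡ-≡ (B.χ c i + B.χ c j) _ _ (trans (two i j) (trans (sym (two k l)) (cong (_+ (bit (D k) + bit (D l))) (sym eq))))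
      where
      -- Markability is the complement of containing `c`, so equal counts at `c` leave equal counts
      -- of markable factors.
      two : ∀ i j → (B.χ c i + B.χ c j) + (bit (D i) + bit (D j)) ≡ 2
      two i j = trans (ℕ+.interchange (B.χ c i) (B.χ c j) _ _) (cong₂ _+_ (χ+D i) (χ+D j))
      image⇒ : ∀ m m' → B'.image m ≡ B'.image m' → B.image (push m) ≡ B.image (push m') × ⟨ mark , m ⟩ ≡ ⟨ mark , m' ⟩
      image⇒ m m' eq = push-image-by-coordinates m m'
        (ℕ.+-cancelʳ-≡ ⟨ mark , m ⟩ _ _ (trans (⟨⟩-c m) (trans (coord (inject₁ c)) (trans (sym (⟨⟩-c m')) (cong (⟨ B.χ c , push m' ⟩ +_) (sym meq)))))) eq , meq
        where
        coord = B'.image-at m m' eq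
        deg : degree m ≡ degree m'
        deg = ℕ.*-cancelʳ-≡ (degree m) (degree m') (suc rank) (trans (sym (degree-image m)) (trans (cong degree eq) (degree-image m')))
        -- The mark count is the degree minus the new coordinate, and the image fixes both.
        meq : ⟨ mark , m ⟩ ≡ ⟨ mark , m' ⟩
        meq = ℕ.+-cancelˡ-≡ ⟨ B'.χ (fromℕ d) , m ⟩ _ _ (trans (⟨⟩-new m) (trans deg (trans (sym (⟨⟩-new m')) (cong (_+ ⟨ mark , m' ⟩) (sym (coord (fromℕ d)))))))
      image⇐ : ∀ m m' → degree m ≡ degree m' → B.image (push m) ≡ B.image (push m') → ⟨ mark , m ⟩ ≡ ⟨ mark , m' ⟩ → B'.image m ≡ B'.image m'
      image⇐ m m' deg eq meq = image-by-coordinates m m'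
        (ℕ.+-cancelʳ-≡ ⟨ mark , m ⟩ _ _ (trans (⟨⟩-new m) (trans deg (trans (sym (⟨⟩-new m')) (cong (⟨ B'.χ (fromℕ d) , m' ⟩ +_) (sym meq))))))
        (trans (sym (⟨⟩-c m)) (trans (cong₂ _+_ (B.image-at (push m) (push m') eq c) meq) (⟨⟩-c m'))) eq

  series-isExtension : (isB : BasisPred d) (c : Fin d) → IsExtension true c isB (series isB c)
  series-isExtension isB c = record { unmarked = unmarked ; marked = marked }
    where
    unmarked : ∀ A → series isB c (A ∷ʳ true) ≡ isB A
    unmarked A rewrite last-∷ʳ true A | init-∷ʳ true A = refl
    marked : ∀ A → series isB c (A ∷ʳ false) ≡ does (lookup A c ≟ᵇ true) ∧ isB (A [ c ]≔ false)
    marked A rewrite last-∷ʳ false A | init-∷ʳ false A with lookup A c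
    ... | true  = refl
    ... | false = refl

  map-not-not : (A : SubsetD d) → V.map not (V.map not A) ≡ A
  map-not-not A = trans (sym (map-∘ not not A)) (trans (map-cong not-involutive A) (map-id A))

  -- Complementation negates the appended coordinate and the value set at `c`, so the series
  -- description of the dual turns into the one with `β` negated.
  parallel-isExtension : (isB : BasisPred d) (c : Fin d) → IsExtension false c isB (parallel isB c)
  parallel-isExtension isB c = record { unmarked = unmarked ; marked = marked }
    where
    module S = IsExtension (series-isExtension (dual isB) c)
    open ≡-Reasoning
    unmarked : ∀ A → parallel isB c (A ∷ʳ false) ≡ isB A
    unmarked A = begin
      series (dual isB) c (V.map not (A ∷ʳ false))   ≡⟨ cong (series (dual isB) c) (map-∷ʳ not false A) ⟩
      series (dual isB) c (V.map not A ∷ʳ true)      ≡⟨ S.unmarked (V.map not A) ⟩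
      isB (V.map not (V.map not A))                  ≡⟨ cong isB (map-not-not A) ⟩
      isB A                                          ∎
    marked : ∀ A → parallel isB c (A ∷ʳ true) ≡ does (lookup A c ≟ᵇ false) ∧ isB (A [ c ]≔ true)
    marked A = begin
      series (dual isB) c (V.map not (A ∷ʳ true))                                               ≡⟨ cong (series (dual isB) c) (map-∷ʳ not true A) ⟩
      series (dual isB) c (V.map not A ∷ʳ false)                                                ≡⟨ S.marked (V.map not A) ⟩
      does (lookup (V.map not A) c ≟ᵇ true) ∧ isB (V.map not (V.map not A [ c ]≔ false))        ≡⟨ cong₂ _∧_ (at-c (lookup A c) (lookup-map c not A)) (cong isB complement) ⟩
      does (lookup A c ≟ᵇ false) ∧ isB (A [ c ]≔ true)                                          ∎
      where
      at-c : ∀ b {b'} → b' ≡ not b → does (b' ≟ᵇ true) ≡ does (b ≟ᵇ false)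
      at-c true  refl = refl
      at-c false refl = refl
      complement : V.map not (V.map not A [ c ]≔ false) ≡ A [ c ]≔ true
      complement = trans (map-[]≔ not (V.map not A) c) (cong (_[ c ]≔ true) (map-not-not A))

theorem2p6 : ∀ {c ℓ} (K : Field c ℓ) (d : ℕ) (isB : BasisPred d) →
    IsMatroid isB → (cc : Fin d) →
    (InMQG K isB → InMQG K (series isB cc) × InMQG K (parallel isB cc)) ×
    (InMQ K isB → InMQ K (series isB cc) × InMQ K (parallel isB cc))
theorem2p6 K d isB M c =
  ( (λ G → let q = M.QuadGroebner⇒QuadraticInitial G in
      S.QuadraticInitial⇒QuadGroebner (QuadraticInitial-cover series-cover q)
    , P.QuadraticInitial⇒QuadGroebner (QuadraticInitial-cover parallel-cover q))
  , (λ G → let q = M.QuadGenerated⇒Connected G in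
      S.Connected⇒QuadGenerated (Cover.Connected-cover series-cover q)
    , P.Connected⇒QuadGenerated (Cover.Connected-cover parallel-cover q)) )
  where
  open Covers using (module Cover)
  open InitialIdeals.GB K using (QuadraticInitial-cover)
  open Extensions
  open Series M (series-isExtension isB c) using (series-cover)
  open Parallel (parallel-isExtension isB c) using (parallel-cover)
  module M = ToricIdeals.ToricIdeal K isB
  module S = ToricIdeals.ToricIdeal K (series isB c)
  module P = ToricIdeals.ToricIdeal K (parallel isB c)
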